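{- The complete Urysohn space $\mathfrak{U}$ is geometrically Rado on any countable integer-distance free dense set. More precisely, let $G_1=(U_1,E_1)$ and $G_2=(U_2,E_2)$ be two g.e.c. graphs on countable integer-distance free dense sets $U_1,U_2\subseteq\mathfrak{U}$ respectively. Then $G_1$ and $G_2$ are isomorphic (as graphs).
   Context: The (complete) Urysohn space $\mathfrak{U}$ is the unique (up to isometry) complete separable metric space which contains an isometric copy of every separable metric space and is ultrahomogeneous: any isometry between finite subsets extends to an isometry of $\mathfrak{U}$ onto itself. A subset $U\subseteq\mathfrak{U}$ is integer-distance free if $d(x,y)\notin\mathbb{N}$ for all $x\ne y$ in $U$. A (simple, undirected) graph with vertex set a dense subset $S$ of a metric space $(X,d)$ is g.e.c. if (i) any two adjacent $u,v\in S$ satisfy $d(u,v)<1$; and (ii) for any $s\in S$, any disjoint finite $A,B\subseteq S$ contained in the open unit ball $B_1(s)$, and any $\epsilon>0$, there is $v\in S\setminus(A\cup B)$ with $d(s,v)<\epsilon$ adjacent to every vertex in $A$ and to no vertex in $B$. A metric space $(X,d)$ is geometrically Rado on a countable subset $V\subseteq X$ if two samplings of geometric random graphs on $V$ are almost surely isomorphic, where a geometric random graph on $V$ is obtained by making $x,y\in V$ adjacent, independently with probability $p\in(0,1)$, whenever $d(x,y)<1$ (and non-adjacent otherwise). Geometric random graphs on a countable dense set are almost surely g.e.c. -}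

module Defs where

open import Algebra.Bundles using (CommutativeRing)
open import Algebra.Definitions.RawMonoid using () renaming (_×_ to multiple)
open import Data.Bool using (Bool; true; false; if_then_else_)
open import Data.Fin using (Fin; zero; suc)
open import Data.List using (List; map; foldr; applyUpTo)
open import Data.List.Relation.Unary.All using (All)
open import Data.List.Relation.Unary.Unique.Propositional using (Unique)
import Data.List.Membership.Setoid as Membership
import Data.List.Relation.Binary.Disjoint.Setoid as Disjointness
open import Data.Maybe using (Maybe; maybe′)
import Data.Maybe.Relation.Unary.Any as Maybe
open import Data.Nat using (ℕ; _⊓_; _⊔_) renaming (_≤_ to _≤ℕ_)
open import Data.Nat.Properties using (⊓-comm; ⊔-comm)
open import Data.Product using (Σ; ∃; ∃-syntax; _×_; _,_; proj₁; proj₂)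
open import Function.Bundles using (Bijection; Injection; _⇔_)
open import Function.Metric.Structures using (IsGeneralMetric)
open import Level using (0ℓ)
open import Relation.Binary using (Rel; Setoid; IsStrictTotalOrder; Symmetric; Irreflexive; _Respects₂_)
import Relation.Binary.Construct.On as On
import Relation.Binary.Construct.StrictToNonStrict as ToNonStrict
open import Relation.Binary.PropositionalEquality as ≡ using (_≡_)
open import Relation.Nullary using (¬_)
open import Relation.Unary using (Pred)

-- The real numbers are taken axiomatically: a Dedekind-complete ordered
-- field is unique up to isomorphism, so a statement about an arbitrary one
-- is a statement about ℝ.

record CompleteOrderedField : Set₁ where
  field
    commutativeRing : CommutativeRing 0ℓ 0ℓ

  open CommutativeRing commutativeRing public

  infix 4 _<_
  field
    _<_                : Rel Carrier 0ℓ
    isStrictTotalOrder : IsStrictTotalOrder _≈_ _<_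

  infix 4 _≤_
  _≤_ : Rel Carrier 0ℓ
  _≤_ = ToNonStrict._≤_ _≈_ _<_

  _IsUpperBoundOf_ : Carrier → Pred Carrier 0ℓ → Set
  b IsUpperBoundOf P = ∀ x → P x → x ≤ b

  field
    +-monoˡ-<  : ∀ z {x y} → x < y → x + z < y + z
    *-positive : ∀ {x y} → 0# < x → 0# < y → 0# < x * y
    0≉1        : ¬ 0# ≈ 1#
    inverse    : ∀ x → ¬ x ≈ 0# → ∃[ y ] x * y ≈ 1#
    supremum   : ∀ (P : Pred Carrier 0ℓ) → ∃ P → ∃ (_IsUpperBoundOf P) →
                 ∃[ s ] (s IsUpperBoundOf P) × (∀ b → b IsUpperBoundOf P → s ≤ b)

  fromℕ : ℕ → Carrier
  fromℕ n = multiple +-rawMonoid n 1#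

  sum product : List Carrier → Carrier
  sum     = foldr _+_ 0#
  product = foldr _*_ 1#

record Graph (V : Setoid 0ℓ 0ℓ) : Set₁ where
  open Setoid V using (Carrier; _≈_)
  infix 4 _~_
  field
    _~_    : Rel Carrier 0ℓ
    resp   : _~_ Respects₂ _≈_
    sym    : Symmetric _~_
    irrefl : Irreflexive _≈_ _~_

infix 4 _≅_
record _≅_ {V W : Setoid 0ℓ 0ℓ} (G : Graph V) (H : Graph W) : Set where
  private
    module G = Graph G
    module H = Graph H
  field
    bijection : Bijection V W
  open Bijection bijection using (to)
  field
    adjacency : ∀ u v → (u G.~ v) ⇔ (to u H.~ to v)

-- A cylinder fixes the outcomes of finitely many pairwise distinct coins.

record Cylinder (I : Set) : Set where
  field
    constraints : List (I × Bool)
    distinct    : Unique (map proj₁ constraints)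

infix 4 _∈ᶜ_
_∈ᶜ_ : {I : Set} → (I → Bool) → Cylinder I → Set
ω ∈ᶜ C = All (λ (i , b) → ω i ≡ b) (Cylinder.constraints C)

module _ (ℝ : CompleteOrderedField) where

  open CompleteOrderedField ℝ
    using (Carrier; _≈_; _<_; _≤_; _+_; _-_; 0#; 1#; sum; product)

  record MetricSpace : Set₁ where
    field
      Point    : Set
      _≈ₚ_     : Rel Point 0ℓ
      d        : Point → Point → Carrier
      isMetric : IsGeneralMetric _≈ₚ_ _≈_ _≤_ 0# _+_ d

    space : Setoid 0ℓ 0ℓ
    space = record { isEquivalence = IsGeneralMetric.≈-isEquivalence isMetric }

  -- The product measure on I → Bool of independent coins, each showing true
  -- with probability p.

  module _ {I : Set} (p : Carrier) where

    measure : Cylinder I → Carrier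
    measure C = product (map (λ (_ , b) → if b then p else 1# - p) (Cylinder.constraints C))

    -- Outer measure zero. The value nothing in a cover stands for the empty
    -- set, so that finite covers are included. All terms are nonnegative, so
    -- bounding the partial sums bounds the infinite sum.
    Null : Pred (I → Bool) 0ℓ → Set
    Null N = ∀ ε → 0# < ε → Σ (ℕ → Maybe (Cylinder I)) λ cover →
      (∀ ω → N ω → ∃[ n ] Maybe.Any (ω ∈ᶜ_) (cover n)) ×
      (∀ n → sum (applyUpTo (λ k → maybe′ measure 0# (cover k)) n) ≤ ε)

    AlmostSurely : Pred (I → Bool) 0ℓ → Set
    AlmostSurely P = Null (λ ω → ¬ P ω)

module _ {ℝ : CompleteOrderedField} where

  open CompleteOrderedField ℝ using (Carrier; _≈_; _<_; _≤_; 0#; 1#; fromℕ)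

  IsIsometric : (X Y : MetricSpace ℝ) → (MetricSpace.Point X → MetricSpace.Point Y) → Set
  IsIsometric X Y f = ∀ x y → MetricSpace.d Y (f x) (f y) ≈ MetricSpace.d X x y

  module _ (X : MetricSpace ℝ) where

    open MetricSpace X

    -- A predicate S need not respect ≈ₚ; the subset meant is the set of
    -- points equal to some point satisfying S.
    subsetoid : Pred Point 0ℓ → Setoid 0ℓ 0ℓ
    subsetoid S = On.setoid {B = Σ Point S} space proj₁

    Countable : Pred Point 0ℓ → Set
    Countable S = Injection (subsetoid S) (≡.setoid ℕ)

    Dense : Pred Point 0ℓ → Set
    Dense S = ∀ x ε → 0# < ε → ∃[ s ] S s × d x s < ε

    Separable : Set₁
    Separable = ∃[ S ] Countable S × Dense S

    Complete : Set
    Complete = ∀ (x : ℕ → Point) →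
      (∀ ε → 0# < ε → ∃[ N ] ∀ m n → N ≤ℕ m → N ≤ℕ n → d (x m) (x n) < ε) →
      ∃[ l ] ∀ ε → 0# < ε → ∃[ N ] ∀ n → N ≤ℕ n → d (x n) l < ε

    Ultrahomogeneous : Set
    Ultrahomogeneous = ∀ n (x y : Fin n → Point) →
      (∀ i j → d (x i) (x j) ≈ d (y i) (y j)) →
      ∃[ φ ] IsIsometric X X φ × (∀ z → ∃[ w ] φ w ≈ₚ z) × (∀ i → φ (x i) ≈ₚ y i)

    IntegerDistanceFree : Pred Point 0ℓ → Set
    IntegerDistanceFree S = ∀ x y → S x → S y → ¬ x ≈ₚ y → ∀ n → ¬ d x y ≈ fromℕ n

    module _ (S : Pred Point 0ℓ) where

      open Setoid (subsetoid S) using () renaming (Carrier to Vertex; _≈_ to _≈ᵥ_)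
      open Membership (subsetoid S) using (_∉_)
      open Disjointness (subsetoid S) using (Disjoint)

      dist : Vertex → Vertex → Carrier
      dist u v = d (proj₁ u) (proj₁ v)

      -- Density of S, which the notion presupposes, is not part of this record.
      record IsGEC (G : Graph (subsetoid S)) : Set where
        open Graph G
        field
          threshold : ∀ u v → u ~ v → dist u v < 1#
          extension : ∀ s (A B : List Vertex) → Disjoint A B →
            All (λ a → dist s a < 1#) A → All (λ b → dist s b < 1#) B →
            ∀ ε → 0# < ε →
            ∃[ v ] v ∉ A × v ∉ B × dist s v < ε ×
                   All (λ a → v ~ a) A × All (λ b → ¬ v ~ b) B

      -- The injection c : S → ℕ labels the unordered pair {u , v} by
      -- (min (c u) (c v) , max (c u) (c v)), the index of its coin; coins at
      -- other indices are never read.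
      module _ (c : Countable S) where

        open Injection c using (to; cong)

        coin : (ℕ × ℕ → Bool) → Vertex → Vertex → Bool
        coin ω u v = ω (to u ⊓ to v , to u ⊔ to v)

        randomGraph : (ℕ × ℕ → Bool) → Graph (subsetoid S)
        randomGraph ω = record
          { _~_    = Adjacent
          ; resp   = (λ {u} {v} {w} → respʳ {u} {v} {w})
                   , (λ {u} {v} {w} v≈w e → symmetric {u} {w} (respʳ {u} {v} {w} v≈w (symmetric {v} {u} e)))
          ; sym    = λ {u} {v} → symmetric {u} {v}
          ; irrefl = λ u≈v (u≉v , _) → u≉v u≈v
          }
          where
          open Setoid (subsetoid S) using (sym; trans)
          module M = IsGeneralMetric isMetric
          open CompleteOrderedField ℝ using (isStrictTotalOrder)
          open IsStrictTotalOrder isStrictTotalOrder using (<-respˡ-≈)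

          Adjacent : Rel Vertex 0ℓ
          Adjacent u v = (¬ u ≈ᵥ v) × dist u v < 1# × coin ω u v ≡ true

          symmetric : Symmetric Adjacent
          symmetric {u} {v} (u≉v , near , heads) =
            (λ v≈u → u≉v (sym {v} {u} v≈u)) ,
            <-respˡ-≈ (M.sym (proj₁ u) (proj₁ v)) near ,
            ≡.trans (≡.cong₂ (λ i j → ω (i , j)) (⊓-comm (to v) (to u)) (⊔-comm (to v) (to u))) heads

          respʳ : ∀ {u v w} → v ≈ᵥ w → Adjacent u v → Adjacent u w
          respʳ {u} {v} {w} v≈w (u≉v , near , heads) =
            (λ u≈w → u≉v (trans {u} {w} {v} u≈w (sym {v} {w} v≈w))) ,
            <-respˡ-≈ (M.cong M.EqC.refl v≈w) near ,
            ≡.trans (≡.cong (λ k → ω (to u ⊓ k , to u ⊔ k)) (≡.sym (cong {v} {w} v≈w))) heads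

        -- The two samplings use the disjoint families of coins with first
        -- index zero and suc zero, hence are independent.
        GeometricallyRado : Set
        GeometricallyRado = ∀ p → 0# < p → p < 1# →
          AlmostSurely ℝ {Fin 2 × ℕ × ℕ} p λ ω →
            randomGraph (λ e → ω (zero , e)) ≅ randomGraph (λ e → ω (suc zero , e))

  Universal : MetricSpace ℝ → Set₁
  Universal X = ∀ (Y : MetricSpace ℝ) → Separable Y → ∃ (IsIsometric Y X)

  record IsUrysohn (X : MetricSpace ℝ) : Set₁ where
    field
      complete         : Complete X
      separable        : Separable X
      universal        : Universal X
      ultrahomogeneous : Ultrahomogeneous X

{-# OPTIONS --safe #-}
module Submission where

-- Back and forth through finite partial maps that preserve adjacency and the
-- integer part of every distance. To extend such a map x i ↦ y i to a new
-- point u, take intervals (aᵢ , aᵢ + 1) around the distances d (u , x i); no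
-- distance is an integer, so the intervals are open. The triangle inequalities
-- through u translate into inequalities between integers and the distances
-- d (x i , x j), which only depend on integer parts and hence hold for the
-- d (y i , y j). They suffice for a Katětov function on the y i with values in
-- the same intervals, which some point z of 𝔘 realizes; near z, density and
-- the extension property give the image of u.
--
-- A random graph violates an instance of the extension property only if
-- infinitely many disjoint and equally likely sets of coins all fail to show
-- a given pattern; there are countably many instances up to approximation.
open import Defs
open import Axiom.ExcludedMiddle using (ExcludedMiddle)
import Algebra.Properties.Monoid.Mult
import Algebra.Properties.Ring
import Algebra.Properties.Semiring.Exp
import Algebra.Solver.Ring.NaturalCoefficients.Default
open import Data.Bool using (Bool; true; false; not; if_then_else_)
import Data.Bool.Properties as Bool
open import Data.Fin using (Fin; zero; suc; toℕ)
open import Data.List using (List; []; _∷_; _++_; map; concat; filter; length; allFin;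
  applyUpTo; upTo; cartesianProduct; cartesianProductWith)
open import Data.List.Extrema using (min; argmin-all; min≤v⁺)
open import Data.List.Extrema.Nat using (max; xs≤max)
open import Data.List.Membership.Propositional.Properties
  using (∈-allFin; ∈-cartesianProduct⁺; ∈-filter⁺; ∈-map⁺; ∈-upTo⁺)
open import Data.List.Properties using (map-++; map-∘; length-map; length-applyUpTo)
open import Data.List.Relation.Binary.Sublist.Propositional using (_⊆_; _∷ʳ_; []; _∷_; minimum)
import Data.List.Relation.Binary.Sublist.Propositional.Properties as Sublist
open import Data.List.Relation.Unary.All as All using (All; []; _∷_)
import Data.List.Relation.Unary.All.Properties as All
open import Data.List.Relation.Unary.AllPairs using ([]; _∷_)
open import Data.List.Relation.Unary.Any as Any using (Any; here; there)
import Data.List.Relation.Unary.Any.Properties as Any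
open import Data.List.Relation.Unary.Unique.Propositional using (Unique)
import Data.List.Relation.Unary.Unique.Propositional.Properties as Unique
open import Data.Maybe using (Maybe; just; nothing; maybe′)
import Data.Maybe.Relation.Unary.Any as Maybe
open import Data.Nat as ℕ using (ℕ; zero; suc)
open import Data.Nat.Binary as ℕᵇ using (ℕᵇ; 2[1+_]; 1+[2_])
import Data.Nat.Binary.Properties as ℕᵇ
import Data.Nat.Properties as ℕ
open import Data.Product using (Σ; ∃-syntax; _×_; _,_; proj₁; proj₂; swap)
open import Data.Sum using (_⊎_; inj₁; inj₂)
open import Data.Unit using (⊤; tt)
import Data.Vec.Functional as Vector
open import Function using (_∘_; id; _⇔_; mk⇔; Equivalence; Injection)
open import Function.Metric.Structures using (IsGeneralMetric)
open import Level using (0ℓ)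
open import Relation.Binary using (IsStrictTotalOrder; Reflexive; Rel; Setoid; StrictPartialOrder;
  Symmetric; TotalOrder; tri<; tri≈; tri>)
import Relation.Binary.Construct.StrictToNonStrict as ToNonStrict
open import Relation.Binary.PropositionalEquality as ≡ using (_≡_)
import Relation.Binary.Reasoning.Setoid
import Relation.Binary.Reasoning.StrictPartialOrder
open import Relation.Nullary using (¬_; Dec; does; yes; no; contradiction)
open import Relation.Nullary.Decidable using (decidable-stable; dec-true; dec-false)
open import Relation.Unary using (Pred)

-- Ordered fields

module OrderedField (em : ExcludedMiddle 0ℓ) (ℝ : CompleteOrderedField) where

  open CompleteOrderedField ℝ public
    using (Carrier; _≈_; _<_; _≤_; _+_; _-_; _*_; -_; 0#; 1#; fromℕ; sum; product; refl; sym; trans; setoid; reflexive;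
           +-cong; +-congˡ; +-congʳ; +-assoc; +-comm; +-identityˡ; +-identityʳ; -‿cong; -‿inverseˡ; -‿inverseʳ;
           *-cong; *-congˡ; *-congʳ; *-assoc; *-comm; *-identityˡ; *-identityʳ; distribˡ; distribʳ; zeroˡ; zeroʳ;
           +-monoˡ-<; *-positive; 0≉1; inverse; supremum)
  open CompleteOrderedField ℝ using (isStrictTotalOrder; semiring; ring; +-monoid; commutativeSemiring)
  open IsStrictTotalOrder isStrictTotalOrder public
    using (compare; _<?_; <-resp-≈; <-respˡ-≈; <-respʳ-≈; isStrictPartialOrder)
    renaming (irrefl to <-irrefl; trans to <-trans; asym to <-asym)

  <-strictPartialOrder : StrictPartialOrder 0ℓ 0ℓ 0ℓ
  <-strictPartialOrder = record { isStrictPartialOrder = isStrictPartialOrder }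

  ≤-totalOrder : TotalOrder 0ℓ 0ℓ 0ℓ
  ≤-totalOrder = record
    { isTotalOrder = ToNonStrict.isTotalOrder _≈_ _<_ isStrictTotalOrder }

  open TotalOrder ≤-totalOrder public using ()
    renaming (refl to ≤-refl; trans to ≤-trans; reflexive to ≤-reflexive)

  module ≤-Reasoning = Relation.Binary.Reasoning.StrictPartialOrder <-strictPartialOrder

  open Algebra.Properties.Semiring.Exp semiring public using (_^_)
  open Algebra.Properties.Monoid.Mult +-monoid using (×-homo-+)
  module Solver = Algebra.Solver.Ring.NaturalCoefficients.Default commutativeSemiring
  open Solver using (solve; _:+_; _:*_; _:=_; con)
  open Algebra.Properties.Ring ring using (-‿distribʳ-*; -‿involutive)

  private
    variable
      v w x y z : Carrier

  <⇒≤ : x < y → x ≤ y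
  <⇒≤ = inj₁

  ≮⇒≥ : ¬ x < y → y ≤ x
  ≮⇒≥ {x} {y} x≮y with compare x y
  ... | tri< x<y _ _ = contradiction x<y x≮y
  ... | tri≈ _ x≈y _ = inj₂ (sym x≈y)
  ... | tri> _ _ y<x = inj₁ y<x

  ≤-<-trans : x ≤ y → y < z → x < z
  ≤-<-trans (inj₁ p) q = <-trans p q
  ≤-<-trans (inj₂ p) q = <-respˡ-≈ (sym p) q

  <-≤-trans : x < y → y ≤ z → x < z
  <-≤-trans p (inj₁ q) = <-trans p q
  <-≤-trans p (inj₂ q) = <-respʳ-≈ q p

  ≤⇒≯ : x ≤ y → ¬ y < x
  ≤⇒≯ p q = <-irrefl refl (≤-<-trans p q)

  +-monoʳ-< : ∀ z → x < y → z + x < z + y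
  +-monoʳ-< z p = <-resp-≈ .proj₁ (+-comm _ z) (<-resp-≈ .proj₂ (+-comm _ z) (+-monoˡ-< z p))

  +-mono-< : v < w → x < y → v + x < w + y
  +-mono-< p q = <-trans (+-monoˡ-< _ p) (+-monoʳ-< _ q)

  +-monoˡ-≤ : ∀ z → x ≤ y → x + z ≤ y + z
  +-monoˡ-≤ z (inj₁ p) = inj₁ (+-monoˡ-< z p)
  +-monoˡ-≤ z (inj₂ p) = inj₂ (+-congʳ p)

  +-monoʳ-≤ : ∀ z → x ≤ y → z + x ≤ z + y
  +-monoʳ-≤ z (inj₁ p) = inj₁ (+-monoʳ-< z p)
  +-monoʳ-≤ z (inj₂ p) = inj₂ (+-congˡ p)

  +-mono-≤ : v ≤ w → x ≤ y → v + x ≤ w + y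
  +-mono-≤ p q = ≤-trans (+-monoˡ-≤ _ p) (+-monoʳ-≤ _ q)

  +-cancelʳ-≈ : ∀ z → x + z ≈ y + z → x ≈ y
  +-cancelʳ-≈ {x} {y} z p = begin
    x               ≈⟨ cancel x ⟨
    (x + z) + - z   ≈⟨ +-congʳ p ⟩
    (y + z) + - z   ≈⟨ cancel y ⟩
    y               ∎
    where
    open Relation.Binary.Reasoning.Setoid setoid
    cancel : ∀ x → (x + z) + - z ≈ x
    cancel x = trans (+-assoc x z (- z)) (trans (+-congˡ (-‿inverseʳ z)) (+-identityʳ x))

  +-cancelʳ-< : ∀ z → x + z < y + z → x < y
  +-cancelʳ-< {x} {y} z p with compare x y
  ... | tri< q _ _ = q
  ... | tri≈ _ q _ = contradiction p (<-irrefl (+-congʳ q))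
  ... | tri> _ _ q = contradiction p (<-asym (+-monoˡ-< z q))

  +-cancelʳ-≤ : ∀ z → x + z ≤ y + z → x ≤ y
  +-cancelʳ-≤ z (inj₁ p) = inj₁ (+-cancelʳ-< z p)
  +-cancelʳ-≤ z (inj₂ p) = inj₂ (+-cancelʳ-≈ z p)

  x-y+y≈x : ∀ x y → (x - y) + y ≈ x
  x-y+y≈x x y = trans (+-assoc x _ _) (trans (+-congˡ (-‿inverseˡ y)) (+-identityʳ x))

  x<x+y : ∀ x → 0# < y → x < x + y
  x<x+y x 0<y = <-respˡ-≈ (+-identityʳ x) (+-monoʳ-< x 0<y)

  +-positive : 0# < x → 0# < y → 0# < x + y
  +-positive p q = <-trans p (x<x+y _ q)

  +-nonneg : 0# ≤ x → 0# ≤ y → 0# ≤ x + y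
  +-nonneg p q = ≤-trans (≤-reflexive (sym (+-identityʳ 0#))) (+-mono-≤ p q)

  x<y⇒∃δ : x < y → ∃[ δ ] 0# < δ × x + δ ≈ y
  x<y⇒∃δ {x} {y} x<y = y - x , 0<δ , x+δ≈y
    where
    x+δ≈y : x + (y - x) ≈ y
    x+δ≈y = trans (+-comm x (y - x)) (x-y+y≈x y x)
    0<δ : 0# < y - x
    0<δ = <-respˡ-≈ (-‿inverseʳ x) (+-monoˡ-< (- x) x<y)

  *-monoʳ-< : 0# < z → x < y → z * x < z * y
  *-monoʳ-< {z} 0<z x<y with x<y⇒∃δ x<y
  ... | δ , 0<δ , x+δ≈y = <-respʳ-≈
    (trans (sym (distribˡ z _ δ)) (*-congˡ x+δ≈y)) (x<x+y _ (*-positive 0<z 0<δ))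

  *-monoʳ-≤ : 0# ≤ z → x ≤ y → z * x ≤ z * y
  *-monoʳ-≤ (inj₂ 0≈z) _ = inj₂ (trans (0* _) (sym (0* _)))
    where
    0* : ∀ x → _ * x ≈ 0#
    0* x = trans (*-congʳ (sym 0≈z)) (zeroˡ x)
  *-monoʳ-≤ (inj₁ 0<z) (inj₁ x<y) = inj₁ (*-monoʳ-< 0<z x<y)
  *-monoʳ-≤ _ (inj₂ x≈y) = inj₂ (*-congˡ x≈y)

  *-nonneg : 0# ≤ x → 0# ≤ y → 0# ≤ x * y
  *-nonneg p q = ≤-trans (≤-reflexive (sym (zeroʳ _))) (*-monoʳ-≤ p q)

  0<1 : 0# < 1#
  0<1 with compare 0# 1#
  ... | tri< p _ _ = p
  ... | tri≈ _ p _ = contradiction p 0≉1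
  ... | tri> _ _ 1<0 = <-respʳ-≈ square (*-positive 0<-1 0<-1)
    where
    0<-1 : 0# < - 1#
    0<-1 = <-respʳ-≈ (+-identityˡ _) (<-respˡ-≈ (-‿inverseʳ 1#) (+-monoˡ-< (- 1#) 1<0))
    square : - 1# * - 1# ≈ 1#
    square = trans (sym (-‿distribʳ-* (- 1#) 1#)) (trans (-‿cong (*-identityʳ _)) (-‿involutive 1#))

  inverse-positive : 0# < x → ∃[ y ] 0# < y × x * y ≈ 1#
  inverse-positive {x} 0<x with inverse x (λ x≈0 → <-irrefl (sym x≈0) 0<x)
  ... | y , xy≈1 with compare 0# y
  ...   | tri< p _ _ = y , p , xy≈1
  ...   | tri≈ _ p _ = contradiction (trans (trans (sym (zeroʳ x)) (*-congˡ p)) xy≈1) 0≉1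
  ...   | tri> _ _ p = contradiction (<-respˡ-≈ xy≈1 (<-respʳ-≈ (zeroʳ x) (*-monoʳ-< 0<x p))) (<-asym 0<1)

  fromℕ-homo-+ : ∀ m n → fromℕ (m ℕ.+ n) ≈ fromℕ m + fromℕ n
  fromℕ-homo-+ = ×-homo-+ 1#

  fromℕ-suc : ∀ n → fromℕ (suc n) ≈ fromℕ n + 1#
  fromℕ-suc n = +-comm 1# (fromℕ n)

  fromℕ-nonneg : ∀ n → 0# ≤ fromℕ n
  fromℕ-nonneg zero = ≤-refl
  fromℕ-nonneg (suc n) = +-nonneg (<⇒≤ 0<1) (fromℕ-nonneg n)

  fromℕ-mono-≤ : ∀ {m n} → m ℕ.≤ n → fromℕ m ≤ fromℕ n
  fromℕ-mono-≤ {n = n} ℕ.z≤n = fromℕ-nonneg n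
  fromℕ-mono-≤ (ℕ.s≤s p) = +-monoʳ-≤ 1# (fromℕ-mono-≤ p)

  fromℕ-cancel-< : ∀ {m n} → fromℕ m < fromℕ n → m ℕ.< n
  fromℕ-cancel-< {m} {n} p with m ℕ.<? n
  ... | yes q = q
  ... | no ¬q = contradiction p (≤⇒≯ (fromℕ-mono-≤ (ℕ.≮⇒≥ ¬q)))

  half : ∃[ h ] 0# < h × h + h ≈ 1#

  half with inverse-positive (+-positive 0<1 0<1)
  ... | h , 0<h , 2h≈1 = h , 0<h ,
    trans (sym (trans (distribʳ h 1# 1#) (+-cong (*-identityˡ h) (*-identityˡ h)))) 2h≈1

  ½ : Carrier
  ½ = half .proj₁

  0<½ : 0# < ½
  0<½ = half .proj₂ .proj₁

  ½+½≈1 : ½ + ½ ≈ 1#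
  ½+½≈1 = half .proj₂ .proj₂

  halves : ∀ x → x * ½ + x * ½ ≈ x
  halves x = trans (sym (distribˡ x ½ ½)) (trans (*-congˡ ½+½≈1) (*-identityʳ x))

  0<x*½ : 0# < x → 0# < x * ½
  0<x*½ 0<x = *-positive 0<x 0<½

  x*½<x : 0# < x → x * ½ < x
  x*½<x 0<x = <-respʳ-≈ (halves _) (x<x+y _ (0<x*½ 0<x))

  gap : x < y → ∃[ δ ] 0# < δ × x + δ < y
  gap {x} x<y with x<y⇒∃δ x<y
  ... | δ , 0<δ , x+δ≈y = δ * ½ , 0<x*½ 0<δ , <-respʳ-≈ x+δ≈y (+-monoʳ-< x (x*½<x 0<δ))

  smaller : ∀ x y → ∃[ z ] z ≤ x × z ≤ y × (0# < x → 0# < y → 0# < z)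
  smaller x y with x <? y
  ... | yes x<y = x , ≤-refl , <⇒≤ x<y , λ p _ → p
  ... | no  x≮y = y , ≮⇒≥ x≮y , ≤-refl , λ _ p → p

  -- Serves every choice of one tolerance over a finite family: slack in strict inequalities, radii
  -- of neighbourhoods, distances to avoided points.
  uniform : ∀ {A : Set} (P : A → Carrier → Set) → (∀ a {δ δ′} → δ′ ≤ δ → P a δ → P a δ′) →
            (∀ a → ∃[ δ ] 0# < δ × P a δ) → ∀ as → ∃[ δ ] 0# < δ × All (λ a → P a δ) as
  uniform P shrink p [] = 1# , 0<1 , []
  uniform P shrink p (a ∷ as) with p a | uniform P shrink p as
  ... | δ , 0<δ , pa | δ′ , 0<δ′ , pas with smaller δ δ′
  ...   | δ″ , δ″≤δ , δ″≤δ′ , 0<δ″ = δ″ , 0<δ″ 0<δ 0<δ′ , shrink a δ″≤δ pa ∷ All.map (λ {b} → shrink b δ″≤δ′) pas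

  -- If fromℕ were bounded with supremum s, then s - 1 would be a smaller bound.
  archimedean : ∀ x → ∃[ n ] x < fromℕ n
  archimedean x with em {∃[ n ] x < fromℕ n}
  ... | yes p = p
  ... | no ¬p with supremum (λ y → ∃[ n ] y ≈ fromℕ n) (0# , 0 , refl)
                       (x , λ y (n , y≈n) → ≤-trans (≤-reflexive y≈n) (≮⇒≥ (λ x<n → ¬p (n , x<n))))
  ...   | s , upper , least = contradiction s-1<s (≤⇒≯ (least (s - 1#) upper′))
    where
    s-1<s : s - 1# < s
    s-1<s = <-respʳ-≈ (x-y+y≈x s 1#) (x<x+y _ 0<1)
    upper′ : ∀ y → (∃[ n ] y ≈ fromℕ n) → y ≤ s - 1#
    upper′ y (n , y≈n) = +-cancelʳ-≤ 1# (begin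
      y + 1#            ≈⟨ +-congʳ y≈n ⟩
      fromℕ n + 1#      ≈⟨ fromℕ-suc n ⟨
      fromℕ (suc n)     ≤⟨ upper _ (suc n , refl) ⟩
      s                 ≈⟨ x-y+y≈x s 1# ⟨
      (s - 1#) + 1#     ∎)
      where open ≤-Reasoning

  floor : ∀ x → 0# ≤ x → ∃[ n ] fromℕ n ≤ x × x < fromℕ (suc n)
  floor x 0≤x with archimedean x
  ... | n , x<n = search n x<n
    where
    search : ∀ n → x < fromℕ n → ∃[ n ] fromℕ n ≤ x × x < fromℕ (suc n)
    search zero x<0 = contradiction x<0 (≤⇒≯ 0≤x)
    search (suc n) x<1+n with compare x (fromℕ n)
    ... | tri< x<n _ _ = search n x<n
    ... | tri≈ _ x≈n _ = n , inj₂ (sym x≈n) , x<1+n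
    ... | tri> _ _ n<x = n , inj₁ n<x , x<1+n

  ^-nonneg : 0# ≤ x → ∀ n → 0# ≤ x ^ n
  ^-nonneg 0≤x zero = <⇒≤ 0<1
  ^-nonneg 0≤x (suc n) = *-nonneg 0≤x (^-nonneg 0≤x n)

  -- Bernoulli's inequality for (1 - q)⁻¹ ≥ 1 + q, cleared of denominators.
  bernoulli : ∀ {t q} → 0# ≤ t → 0# ≤ q → t + q ≈ 1# → ∀ m → t ^ m * (1# + fromℕ m * q) ≤ 1#
  bernoulli {t} {q} 0≤t 0≤q t+q≈1 zero = ≤-reflexive
    (trans (*-identityˡ _) (trans (+-congˡ (zeroˡ q)) (+-identityʳ 1#)))
  bernoulli {t} {q} 0≤t 0≤q t+q≈1 (suc m) = begin
    t * t ^ m * (1# + (1# + fromℕ m) * q)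
      ≈⟨ expand ⟩
    t ^ m * ((t + q * t) + (q * fromℕ m) * t)
      ≤⟨ *-monoʳ-≤ (^-nonneg 0≤t m) (+-mono-≤ (+-monoʳ-≤ t (*-monoʳ-≤ 0≤q t≤1))
           (*-monoʳ-≤ (*-nonneg 0≤q (fromℕ-nonneg m)) t≤1)) ⟩
    t ^ m * ((t + q * 1#) + (q * fromℕ m) * 1#)
      ≈⟨ *-congˡ (+-cong (trans (+-congˡ (*-identityʳ q)) t+q≈1) (trans (*-identityʳ _) (*-comm q _))) ⟩
    t ^ m * (1# + fromℕ m * q)
      ≤⟨ bernoulli 0≤t 0≤q t+q≈1 m ⟩
    1# ∎
    where
    open ≤-Reasoning
    t≤1 : t ≤ 1#
    t≤1 = ≤-trans (≤-reflexive (sym (+-identityʳ t))) (≤-trans (+-monoʳ-≤ t 0≤q) (≤-reflexive t+q≈1))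
    expand : t * t ^ m * (1# + (1# + fromℕ m) * q) ≈ t ^ m * ((t + q * t) + (q * fromℕ m) * t)
    expand = solve 4 (λ t s n q → t :* s :* (con 1 :+ (con 1 :+ n) :* q) := s :* ((t :+ q :* t) :+ (q :* n) :* t))
               refl t (t ^ m) (fromℕ m) q

  -- Take `m` above `1 / (q * ε)`. By `bernoulli`, `t ^ m * (m * q)` is less than 1, and `t ^ m` is
  -- at most `ε` times this number.
  ^-small : ∀ {t q ε} → 0# ≤ t → 0# < q → t + q ≈ 1# → 0# < ε → ∃[ m ] t ^ m < ε
  ^-small {t} {q} {ε} 0≤t 0<q t+q≈1 0<ε with inverse-positive (*-positive 0<q 0<ε)
  ... | y , 0<y , qεy≈1 with archimedean y
  ...   | m , y<m = m , (begin-strict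
    t ^ m                              ≈⟨ *-identityʳ _ ⟨
    t ^ m * 1#                         ≈⟨ *-congˡ qεy≈1 ⟨
    t ^ m * (q * ε * y)                ≤⟨ *-monoʳ-≤ (^-nonneg 0≤t m)
                                            (*-monoʳ-≤ (<⇒≤ (*-positive 0<q 0<ε)) (<⇒≤ y<m)) ⟩
    t ^ m * (q * ε * fromℕ m)          ≈⟨ rearrange ⟩
    ε * (t ^ m * (fromℕ m * q))        <⟨ *-monoʳ-< 0<ε below ⟩
    ε * 1#                             ≈⟨ *-identityʳ ε ⟩
    ε                                  ∎)
    where
    open ≤-Reasoning
    rearrange : t ^ m * (q * ε * fromℕ m) ≈ ε * (t ^ m * (fromℕ m * q))
    rearrange = solve 4 (λ s q ε n → s :* (q :* ε :* n) := ε :* (s :* (n :* q))) refl (t ^ m) q ε (fromℕ m)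
    below : t ^ m * (fromℕ m * q) < 1#
    below with ^-nonneg 0≤t m
    ... | inj₁ 0<s = <-≤-trans (*-monoʳ-< 0<s (<-respʳ-≈ (+-comm _ 1#) (x<x+y _ 0<1)))
                         (bernoulli 0≤t (<⇒≤ 0<q) t+q≈1 m)
    ... | inj₂ 0≈s = <-respˡ-≈ (trans (sym (zeroˡ _)) (*-congʳ 0≈s)) 0<1

-- Back and forth

module BackAndForth
  (em : ExcludedMiddle 0ℓ) {V W : Setoid 0ℓ 0ℓ} (G : Graph V) (H : Graph W)
  (codeV : Injection V (≡.setoid ℕ)) (codeW : Injection W (≡.setoid ℕ))
  (_#_ : Rel (Setoid.Carrier V × Setoid.Carrier W) 0ℓ)
  (#-refl : Reflexive _#_) (#-sym : Symmetric _#_)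
  where

  private
    module V = Setoid V
    module W = Setoid W
    module G = Graph G
    module H = Graph H
    module codeV = Injection codeV
    module codeW = Injection codeW

  Pair : Set
  Pair = V.Carrier × W.Carrier

  -- A finite partial map as a family of pairwise related pairs, repetitions allowed. That it is
  -- single-valued and injective up to equality is not a field: `_#_` will preserve and reflect
  -- equality.
  record Finite : Set where
    field
      {size}   : ℕ
      pair     : Fin size → Pair
      coherent : ∀ i j → pair i # pair j

  open Finite

  infix 4 _∈ᶠ_ _⊑_
  _∈ᶠ_ : Pair → Finite → Set
  p ∈ᶠ f = ∃[ i ] pair f i ≡ p

  _⊑_ : Finite → Finite → Set
  f ⊑ g = ∀ {p} → p ∈ᶠ f → p ∈ᶠ g

  empty : Finite
  empty = record { pair = Vector.[] ; coherent = λ () }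

  push : (p : Pair) (f : Finite) → (∀ i → p # pair f i) → Finite
  push p f p# = record { pair = p Vector.∷ pair f ; coherent = coherent′ }
    where
    coherent′ : ∀ i j → (p Vector.∷ pair f) i # (p Vector.∷ pair f) j
    coherent′ zero    zero    = #-refl
    coherent′ zero    (suc j) = p# j
    coherent′ (suc i) zero    = #-sym (p# i)
    coherent′ (suc i) (suc j) = coherent f i j

  ⊑-push : ∀ {p f p#} → f ⊑ push p f p#
  ⊑-push (i , eq) = suc i , eq

  module _
    (#-≈   : ∀ {v w v′ w′} → (v , w) # (v′ , w′) → v V.≈ v′ ⇔ w W.≈ w′)
    (#-~   : ∀ {v w v′ w′} → (v , w) # (v′ , w′) → v G.~ v′ ⇔ w H.~ w′)
    (forth : ∀ f v → ∃[ w ] ∀ i → (v , w) # pair f i)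
    (back  : ∀ f w → ∃[ v ] ∀ i → (v , w) # pair f i)
    where

    -- Excluded middle decides whether `n` is a code at all. A vertex with code `n` equals the
    -- chosen one only up to `V.≈`, hence the representative `v′`.
    addˡ : ∀ n f → ∃[ g ] f ⊑ g × (∀ v → codeV.to v ≡ n → ∃[ v′ ] ∃[ w ] v′ V.≈ v × (v′ , w) ∈ᶠ g)
    addˡ n f with em {∃[ v ] codeV.to v ≡ n}
    ... | no ∄v = f , (λ p∈f → p∈f) , λ v eq → contradiction (v , eq) ∄v
    ... | yes (v , eq) =
      let (w , v,w#) = forth f v in
      push (v , w) f v,w# , ⊑-push {f = f} {p# = v,w#} ,
      λ v′ eq′ → v , w , codeV.injective (≡.trans eq (≡.sym eq′)) , zero , ≡.refl

    addʳ : ∀ n f → ∃[ g ] f ⊑ g × (∀ w → codeW.to w ≡ n → ∃[ v ] ∃[ w′ ] w′ W.≈ w × (v , w′) ∈ᶠ g)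
    addʳ n f with em {∃[ w ] codeW.to w ≡ n}
    ... | no ∄w = f , (λ p∈f → p∈f) , λ w eq → contradiction (w , eq) ∄w
    ... | yes (w , eq) =
      let (v , v,w#) = back f w in
      push (v , w) f v,w# , ⊑-push {f = f} {p# = v,w#} ,
      λ w′ eq′ → v , w , codeW.injective (≡.trans eq (≡.sym eq′)) , zero , ≡.refl

    stage : ℕ → Finite
    stage zero    = empty
    stage (suc n) = proj₁ (addʳ n (proj₁ (addˡ n (stage n))))

    stage-mono : ∀ {m n} → m ℕ.≤′ n → stage m ⊑ stage n
    stage-mono (ℕ.≤′-reflexive ≡.refl) p∈ = p∈
    stage-mono {n = suc n} (ℕ.≤′-step m≤n) p∈ =
      proj₁ (proj₂ (addʳ n _)) (proj₁ (proj₂ (addˡ n _)) (stage-mono m≤n p∈))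

    Limit : Pair → Set
    Limit p = ∃[ n ] p ∈ᶠ stage n

    -- Stages increase, so both pairs occur in stage `m + n`, whose pairs are related to each other.
    limit-coherent : ∀ {p q} → Limit p → Limit q → p # q
    limit-coherent (m , p∈) (n , q∈) with stage-mono (ℕ.≤⇒≤′ (ℕ.m≤m+n m n)) p∈ | stage-mono (ℕ.≤⇒≤′ (ℕ.m≤n+m n m)) q∈
    ... | i , ≡.refl | j , ≡.refl = coherent (stage (m ℕ.+ n)) i j

    totalˡ : ∀ v → ∃[ w ] ∃[ v′ ] v′ V.≈ v × Limit (v′ , w)
    totalˡ v with proj₂ (proj₂ (addˡ (codeV.to v) (stage (codeV.to v)))) v ≡.refl
    -- Code `n` is treated in passing from stage `n` to stage `suc n`.
    ... | v′ , w , v′≈v , ∈g = w , v′ , v′≈v , suc (codeV.to v) , proj₁ (proj₂ (addʳ (codeV.to v) _)) ∈g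

    totalʳ : ∀ w → ∃[ v ] ∃[ w′ ] w′ W.≈ w × Limit (v , w′)
    totalʳ w with proj₂ (proj₂ (addʳ (codeW.to w) (proj₁ (addˡ (codeW.to w) (stage (codeW.to w)))))) w ≡.refl
    ... | v , w′ , w′≈w , ∈g = v , w′ , w′≈w , suc (codeW.to w) , ∈g

    -- `to` follows the pair of some representative of its argument. Each property is read off from
    -- two pairs in the limit, which are related by `_#_`, and moved along the equalities with the
    -- representatives.
    isomorphic : G ≅ H
    isomorphic = record
      { bijection = record
        { to        = to
        ; cong      = λ {u} {v} u≈v → let _ , u′ , u′≈u , lu = totalˡ u; _ , v′ , v′≈v , lv = totalˡ v in
                        Equivalence.to (#-≈ (limit-coherent lu lv)) (V.trans u′≈u (V.trans u≈v (V.sym v′≈v)))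
        ; bijective = (λ {u} {v} tu≈tv → let _ , u′ , u′≈u , lu = totalˡ u; _ , v′ , v′≈v , lv = totalˡ v in
                        V.trans (V.sym u′≈u) (V.trans (Equivalence.from (#-≈ (limit-coherent lu lv)) tu≈tv) v′≈v))
                    , λ w → let v , w′ , w′≈w , lw = totalʳ w in v , λ {u} u≈v →
                        let _ , u′ , u′≈u , lu = totalˡ u in
                        W.trans (Equivalence.to (#-≈ (limit-coherent lu lw)) (V.trans u′≈u u≈v)) w′≈w
        }
      ; adjacency = λ u v → let _ , u′ , u′≈u , lu = totalˡ u; _ , v′ , v′≈v , lv = totalˡ v
                                e = #-~ (limit-coherent lu lv) in
          mk⇔ (λ u~v → Equivalence.to e (resp (V.sym u′≈u) (V.sym v′≈v) u~v))
              (λ tu~tv → resp u′≈u v′≈v (Equivalence.from e tu~tv))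
      }
      where
      to : V.Carrier → W.Carrier
      to v = proj₁ (totalˡ v)
      resp : ∀ {u u′ v v′} → u V.≈ u′ → v V.≈ v′ → u G.~ v → u′ G.~ v′
      resp u≈u′ v≈v′ u~v = proj₁ G.resp v≈v′ (proj₂ G.resp u≈u′ u~v)

-- Metric spaces

module MetricProperties (em : ExcludedMiddle 0ℓ) {ℝ : CompleteOrderedField} (X : MetricSpace ℝ) where

  open OrderedField em ℝ
  open MetricSpace X public using (Point; _≈ₚ_; d; isMetric)
  open IsGeneralMetric isMetric public using (triangle; ≈⇒0; 0⇒≈; nonNegative)
    renaming (sym to d-sym; cong to d-cong; module EqC to EqP)

  ≉⇒0<d : ∀ {x y} → ¬ x ≈ₚ y → 0# < d x y
  ≉⇒0<d {x} {y} x≉y with compare 0# (d x y)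
  ... | tri< p _ _ = p
  ... | tri≈ _ p _ = contradiction (0⇒≈ (sym p)) x≉y
  ... | tri> _ _ p = contradiction p (≤⇒≯ nonNegative)

  0<d⇒≉ : ∀ {x y} → 0# < d x y → ¬ x ≈ₚ y
  0<d⇒≉ 0<d x≈y = <-irrefl (sym (≈⇒0 x≈y)) 0<d

module _ (em : ExcludedMiddle 0ℓ) {ℝ : CompleteOrderedField} where

  open OrderedField em ℝ

  -- Points at distance zero are declared equal, which turns a pseudometric into a metric; that
  -- distances respect this equality follows from the triangle inequality.
  metricSpace : (A : Set) (δ : A → A → Carrier) → (∀ x → δ x x ≈ 0#) → (∀ x y → 0# ≤ δ x y) →
                (∀ x y → δ x y ≈ δ y x) → (∀ x y z → δ x z ≤ δ x y + δ y z) → MetricSpace ℝ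
  metricSpace A δ δ-refl δ-nonneg δ-sym δ-triangle = record
    { Point    = A
    ; _≈ₚ_     = _∼_
    ; d        = δ
    ; isMetric = record
      { isSemiMetric = record
        { isQuasiSemiMetric = record
          { isPreMetric = record
            { isProtoMetric = record
              { isPartialOrder   = TotalOrder.isPartialOrder ≤-totalOrder
              ; ≈-isEquivalence  = record
                { refl = λ {x} → δ-refl x ; sym = ∼-sym ; trans = ∼-trans }
              ; cong             = λ x∼x′ y∼y′ → antisym (δ-resp (∼-sym x∼x′) (∼-sym y∼y′)) (δ-resp x∼x′ y∼y′)
              ; nonNegative      = δ-nonneg _ _
              }
            ; ≈⇒0 = λ x∼y → x∼y
            }
          ; 0⇒≈ = λ x∼y → x∼y
          }
        ; sym = δ-sym
        }
      ; triangle = δ-triangle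
      }
    }
    where
    open TotalOrder ≤-totalOrder using (antisym)
    _∼_ : A → A → Set
    x ∼ y = δ x y ≈ 0#
    ∼-sym : ∀ {x y} → x ∼ y → y ∼ x
    ∼-sym {x} {y} = trans (δ-sym y x)
    ∼-trans : ∀ {x y z} → x ∼ y → y ∼ z → x ∼ z
    ∼-trans {x} {y} {z} p q = antisym
      (≤-trans (δ-triangle x y z) (≤-reflexive (trans (+-cong p q) (+-identityʳ 0#)))) (δ-nonneg x z)
    δ-resp : ∀ {x x′ y y′} → x ∼ x′ → y ∼ y′ → δ x′ y′ ≤ δ x y
    δ-resp {x} {x′} {y} {y′} p q = begin
      δ x′ y′                    ≤⟨ δ-triangle x′ x y′ ⟩
      δ x′ x + δ x y′            ≤⟨ +-monoʳ-≤ _ (δ-triangle x y y′) ⟩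
      δ x′ x + (δ x y + δ y y′)  ≈⟨ +-cong (∼-sym p) (+-congˡ q) ⟩
      0# + (δ x y + 0#)          ≈⟨ trans (+-identityˡ _) (+-identityʳ _) ⟩
      δ x y                      ∎
      where open ≤-Reasoning

-- One-point extensions in the Urysohn space

module Urysohn (em : ExcludedMiddle 0ℓ) {ℝ : CompleteOrderedField} (𝔘 : MetricSpace ℝ) (isUrysohn : IsUrysohn 𝔘) where

  open OrderedField em ℝ
  open MetricProperties em 𝔘
  open IsUrysohn isUrysohn using (universal; ultrahomogeneous)

  module _ {S : Pred Point 0ℓ} (c : Countable 𝔘 S) {n : ℕ} (y : Fin n → Σ Point S) (g : Fin n → Carrier)
    (0<g : ∀ i → 0# < g i)
    (lipschitz : ∀ i j → g i ≤ g j + dist 𝔘 S (y i) (y j))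
    (subadditive : ∀ i j → dist 𝔘 S (y i) (y j) ≤ g i + g j)
    where

    private
      δ : Maybe (Fin n) → Maybe (Fin n) → Carrier
      δ (just i) (just j) = dist 𝔘 S (y i) (y j)
      δ (just i) nothing  = g i
      δ nothing  (just j) = g j
      δ nothing  nothing  = 0#

      δ-refl : ∀ i → δ i i ≈ 0#
      δ-refl (just i) = ≈⇒0 EqP.refl
      δ-refl nothing  = refl

      δ-nonneg : ∀ i j → 0# ≤ δ i j
      δ-nonneg (just i) (just j) = nonNegative
      δ-nonneg (just i) nothing  = <⇒≤ (0<g i)
      δ-nonneg nothing  (just j) = <⇒≤ (0<g j)
      δ-nonneg nothing  nothing  = ≤-refl

      δ-sym : ∀ i j → δ i j ≈ δ j i
      δ-sym (just i) (just j) = d-sym _ _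
      δ-sym (just i) nothing  = refl
      δ-sym nothing  (just j) = refl
      δ-sym nothing  nothing  = refl

      δ-triangle : ∀ i j k → δ i k ≤ δ i j + δ j k
      δ-triangle (just i) (just j) (just k) = triangle _ _ _
      δ-triangle (just i) (just j) nothing  = ≤-trans (lipschitz i j) (≤-reflexive (+-comm _ _))
      δ-triangle (just i) nothing  (just k) = subadditive i k
      δ-triangle (just i) nothing  nothing  = ≤-reflexive (sym (+-identityʳ _))
      δ-triangle nothing  (just j) (just k) =
        ≤-trans (lipschitz k j) (+-monoʳ-≤ (g j) (≤-reflexive (d-sym _ _)))
      δ-triangle nothing  (just j) nothing  = +-nonneg (<⇒≤ (0<g j)) (<⇒≤ (0<g j))
      δ-triangle nothing  nothing  (just k) = ≤-reflexive (sym (+-identityˡ _))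
      δ-triangle nothing  nothing  nothing  = ≤-reflexive (sym (+-identityˡ _))

      Y : MetricSpace ℝ
      Y = metricSpace em {ℝ} (Maybe (Fin n)) δ δ-refl δ-nonneg δ-sym δ-triangle

      module c = Injection c

      -- Some `y i` may coincide, so the index `i` would not respect the equality of `Y`. The code
      -- from `c` does; it is shifted to leave 0 for the new point.
      code : Maybe (Fin n) → ℕ
      code nothing  = 0
      code (just i) = suc (c.to (y i))

      code-cong : ∀ i j → δ i j ≈ 0# → code i ≡ code j
      code-cong (just i) (just j) p = ≡.cong suc (c.cong (0⇒≈ p))
      code-cong (just i) nothing  p = contradiction (0<g i) (<-irrefl (sym p))
      code-cong nothing  (just j) p = contradiction (0<g j) (<-irrefl (sym p))
      code-cong nothing  nothing  p = ≡.refl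

      code-injective : ∀ i j → code i ≡ code j → δ i j ≈ 0#
      code-injective (just i) (just j) p = ≈⇒0 (c.injective (ℕ.suc-injective p))
      code-injective nothing  nothing  p = refl

      Y-separable : Separable Y
      Y-separable = (λ _ → ⊤)
                  , record { to        = λ (i , _) → code i
                           ; cong      = λ {(i , _)} {(j , _)} → code-cong i j
                           ; injective = λ {(i , _)} {(j , _)} → code-injective i j }
                  , λ i ε 0<ε → i , tt , <-respˡ-≈ (sym (δ-refl i)) 0<ε

    -- `g` is a Katětov function: `Y` adjoins to the `y i` a point `nothing` at distances `g`.
    -- Universality embeds `Y`, and ultrahomogeneity carries the copies of the `y i` back to the
    -- `y i`; the copy of `nothing` goes to `z`.
    katetov : ∃[ z ] ∀ i → d z (proj₁ (y i)) ≈ g i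
    katetov with universal Y Y-separable
    ... | f , f-isometric with ultrahomogeneous n (f ∘ just) (proj₁ ∘ y) (λ i j → f-isometric (just i) (just j))
    ...   | φ , φ-isometric , _ , φf≈y = φ (f nothing) , λ i → trans (d-cong EqP.refl (EqP.sym (φf≈y i)))
              (trans (φ-isometric _ _) (f-isometric nothing (just i)))

-- Extending step isometries

module Steps (em : ExcludedMiddle 0ℓ) (ℝ : CompleteOrderedField) where

  open OrderedField em ℝ

  Within : ℕ → Carrier → Set
  Within n x = fromℕ n < x × x < fromℕ (suc n)

  -- Open intervals suffice, since distances in integer-distance free sets are never positive
  -- integers. Distance 0 is a class of its own, so that `Step` preserves equality and inequality of
  -- points.
  Step : Carrier → Carrier → Set
  Step x y = x ≈ 0# × y ≈ 0# ⊎ ∃[ n ] Within n x × Within n y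

  step-sym : ∀ {x y} → Step x y → Step y x
  step-sym (inj₁ (p , q)) = inj₁ (q , p)
  step-sym (inj₂ (n , p , q)) = inj₂ (n , q , p)

  step-resp : ∀ {x x′ y y′} → x ≈ x′ → y ≈ y′ → Step x y → Step x′ y′
  step-resp x≈x′ y≈y′ (inj₁ (p , q)) = inj₁ (trans (sym x≈x′) p , trans (sym y≈y′) q)
  step-resp x≈x′ y≈y′ (inj₂ (n , (p , q) , (r , s))) = inj₂ (n ,
    (<-respʳ-≈ x≈x′ p , <-respˡ-≈ x≈x′ q) , (<-respʳ-≈ y≈y′ r , <-respˡ-≈ y≈y′ s))

  within⇒0< : ∀ {n x} → Within n x → 0# < x
  within⇒0< {n} (p , _) = ≤-<-trans (fromℕ-nonneg n) p

  step-≈0 : ∀ {x y} → Step x y → x ≈ 0# → y ≈ 0#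
  step-≈0 (inj₁ (_ , y≈0)) _ = y≈0
  step-≈0 (inj₂ (n , w , _)) x≈0 = contradiction (within⇒0< {n} w) (<-irrefl (sym x≈0))

  -- From `n < x < m` follows `suc n ≤ m`, and `y` lies below `suc n`.
  step-preserves-< : ∀ {x y} m → Step x y → x < fromℕ m → y < fromℕ m
  step-preserves-< m (inj₁ (x≈0 , y≈0)) x<m = <-respˡ-≈ (trans x≈0 (sym y≈0)) x<m
  step-preserves-< m (inj₂ (n , (n<x , _) , (_ , y<1+n))) x<m =
    <-≤-trans y<1+n (fromℕ-mono-≤ (fromℕ-cancel-< {n} {m} (<-trans n<x x<m)))

  -- For integers, `m < k + x < k + suc n` gives `m ≤ k + n`, and `y` exceeds `n`. The summand `k`
  -- admits triangle inequalities with two integers in them.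
  step-preserves-> : ∀ {x y} m k → Step x y → fromℕ m < fromℕ k + x → fromℕ m < fromℕ k + y
  step-preserves-> m k (inj₁ (x≈0 , y≈0)) m<k+x = <-respʳ-≈ (+-congˡ (trans x≈0 (sym y≈0))) m<k+x
  step-preserves-> {x} {y} m k (inj₂ (n , (_ , x<1+n) , (n<y , _))) m<k+x = begin-strict
    fromℕ m             ≤⟨ fromℕ-mono-≤ m≤k+n ⟩
    fromℕ (k ℕ.+ n)     ≈⟨ fromℕ-homo-+ k n ⟩
    fromℕ k + fromℕ n   <⟨ +-monoʳ-< _ n<y ⟩
    fromℕ k + y         ∎
    where
    open ≤-Reasoning
    m≤k+n : m ℕ.≤ k ℕ.+ n
    m≤k+n = ℕ.s≤s⁻¹ (≡.subst (suc m ℕ.≤_) (ℕ.+-suc k n) (fromℕ-cancel-< {m} {k ℕ.+ suc n}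
      (<-respʳ-≈ (sym (fromℕ-homo-+ k (suc n))) (<-trans m<k+x (+-monoʳ-< _ x<1+n)))))

module StepRealization
  (em : ExcludedMiddle 0ℓ) {ℝ : CompleteOrderedField} (𝔘 : MetricSpace ℝ) (isUrysohn : IsUrysohn 𝔘) where

  open OrderedField em ℝ
  open Solver using (solve; _:+_; _:=_)
  open MetricProperties em 𝔘
  open Steps em ℝ
  open Urysohn em 𝔘 isUrysohn

  -- The largest function that is 1-Lipschitz and lies below the upper ends
  -- suc (a k) - η, namely min_k (suc (a k) - η + d (y k) -), is a Katětov
  -- function; only pairwise conditions are needed for it to exceed a.
  module _ {S : Pred Point 0ℓ} (c : Countable 𝔘 S) {n : ℕ} (y : Fin n → Σ Point S) (a : Fin n → ℕ)
    (lower : ∀ i k → fromℕ (a i) < fromℕ (suc (a k)) + dist 𝔘 S (y k) (y i))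
    (upper : ∀ k m → dist 𝔘 S (y k) (y m) < fromℕ (suc (a k)) + fromℕ (suc (a m)))
    where

    private
      D : Fin n → Fin n → Carrier
      D i j = dist 𝔘 S (y i) (y j)

      Slack : Fin n × Fin n → Carrier → Set
      Slack (i , k) δ = fromℕ (a i) + δ < fromℕ (suc (a k)) + D k i ×
                        D i k + δ < fromℕ (suc (a i)) + fromℕ (suc (a k))

      abstract
        slack : ∃[ δ ] 0# < δ × All (λ p → Slack p δ) (cartesianProduct (allFin n) (allFin n))
        slack = uniform Slack
          (λ _ δ′≤δ (p , q) → ≤-<-trans (+-monoʳ-≤ _ δ′≤δ) p , ≤-<-trans (+-monoʳ-≤ _ δ′≤δ) q)
          (λ (i , k) → both (gap (lower i k)) (gap (upper i k))) _
          where
          both : ∀ {u v x y} → ∃[ δ ] 0# < δ × u + δ < v → ∃[ δ ] 0# < δ × x + δ < y →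
                 ∃[ δ ] 0# < δ × u + δ < v × x + δ < y
          both (δ , 0<δ , p) (δ′ , 0<δ′ , q) with smaller δ δ′
          ... | δ″ , ≤δ , ≤δ′ , 0<δ″ =
            δ″ , 0<δ″ 0<δ 0<δ′ , ≤-<-trans (+-monoʳ-≤ _ ≤δ) p , ≤-<-trans (+-monoʳ-≤ _ ≤δ′) q

      δ η : Carrier
      δ = slack .proj₁
      -- `D≤u+u` involves two lowered upper ends, which together may cost `δ`.
      η = δ * ½

      0<η : 0# < η
      0<η = 0<x*½ (slack .proj₂ .proj₁)

      slackAt : ∀ i k → fromℕ (a i) + δ < fromℕ (suc (a k)) + D k i ×
                D i k + δ < fromℕ (suc (a i)) + fromℕ (suc (a k))
      slackAt i k = All.lookup (slack .proj₂ .proj₂) (∈-cartesianProduct⁺ (∈-allFin i) (∈-allFin k))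

      u : Fin n → Carrier
      u k = fromℕ (suc (a k)) - η

      u+η≈ : ∀ k → u k + η ≈ fromℕ (suc (a k))
      u+η≈ k = x-y+y≈x _ η

      t : Fin n → Fin n → Carrier
      t i k = u k + D k i

      a<t : ∀ i k → fromℕ (a i) < t i k
      a<t i k = <-trans (x<x+y _ 0<η) (+-cancelʳ-< η (begin-strict
        (fromℕ (a i) + η) + η         ≈⟨ trans (+-assoc _ η η) (+-congˡ (halves δ)) ⟩
        fromℕ (a i) + δ               <⟨ proj₁ (slackAt i k) ⟩
        fromℕ (suc (a k)) + D k i     ≈⟨ +-congʳ (u+η≈ k) ⟨
        (u k + η) + D k i             ≈⟨ solve 3 (λ u η d → (u :+ η) :+ d := (u :+ d) :+ η) refl (u k) η (D k i) ⟩
        t i k + η                     ∎))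
        where open ≤-Reasoning

      D≤u+u : ∀ k m → D k m ≤ u k + u m
      D≤u+u k m = <⇒≤ (+-cancelʳ-< δ (begin-strict
        D k m + δ                                 <⟨ proj₂ (slackAt k m) ⟩
        fromℕ (suc (a k)) + fromℕ (suc (a m))     ≈⟨ +-cong (u+η≈ k) (u+η≈ m) ⟨
        (u k + η) + (u m + η)                     ≈⟨ solve 3 (λ u v η → (u :+ η) :+ (v :+ η) := (u :+ v) :+ (η :+ η))
                                                        refl (u k) (u m) η ⟩
        (u k + u m) + (η + η)                     ≈⟨ +-congˡ (halves δ) ⟩
        (u k + u m) + δ                           ∎))
        where open ≤-Reasoning

      g : Fin n → Carrier
      g i = min ≤-totalOrder (t i i) (map (t i) (allFin n))

      g≤t : ∀ i k → g i ≤ t i k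
      g≤t i k = min≤v⁺ ≤-totalOrder (t i i) (map (t i) (allFin n))
        (inj₂ (Any.map⁺ (Any.map (λ { ≡.refl → ≤-refl }) (∈-allFin k))))

      -- A minimum of a finite family is attained, so it inherits what holds of every member.
      g-elim : ∀ (Q : Carrier → Set) i → (∀ k → Q (t i k)) → Q (g i)
      g-elim Q i q = argmin-all ≤-totalOrder id {xs = map (t i) (allFin n)} {P = Q}
        (q i) (All.map⁺ (All.universal q (allFin n)))

      -- If `g j` is attained at `k`, the candidate for `g i` with the same `k` exceeds it by at
      -- most `D i j`.
      lipschitz : ∀ i j → g i ≤ g j + D i j
      lipschitz i j = g-elim (λ x → g i ≤ x + D i j) j λ k → begin
        g i                          ≤⟨ g≤t i k ⟩
        u k + D k i                  ≤⟨ +-monoʳ-≤ _ (triangle _ _ _) ⟩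
        u k + (D k j + D j i)        ≈⟨ +-congˡ (+-congˡ (d-sym _ _)) ⟩
        u k + (D k j + D i j)        ≈⟨ +-assoc _ _ _ ⟨
        t j k + D i j                ∎
        where open ≤-Reasoning

      -- If the minima are attained at `k` and `m`, go from `y i` to `y j` by way of `y k` and
      -- `y m`; `D≤u+u` bounds the middle leg.
      subadditive : ∀ i j → D i j ≤ g i + g j
      subadditive i j = g-elim (λ x → D i j ≤ x + g j) i λ k → g-elim (λ x → D i j ≤ t i k + x) j λ m → begin
        D i j                              ≤⟨ ≤-trans (triangle _ _ _) (+-monoʳ-≤ _ (triangle _ _ _)) ⟩
        D i k + (D k m + D m j)            ≤⟨ +-mono-≤ (≤-reflexive (d-sym _ _)) (+-monoˡ-≤ _ (D≤u+u k m)) ⟩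
        D k i + ((u k + u m) + D m j)      ≈⟨ solve 4 (λ x u v y → x :+ ((u :+ v) :+ y) := (u :+ x) :+ (v :+ y))
                                                 refl (D k i) (u k) (u m) (D m j) ⟩
        t i k + t j m                      ∎
        where open ≤-Reasoning

      g-within : ∀ i → Within (a i) (g i)
      g-within i = g-elim (fromℕ (a i) <_) i (a<t i) , (begin-strict
        g i                    ≤⟨ g≤t i i ⟩
        u i + D i i            ≈⟨ trans (+-congˡ (≈⇒0 EqP.refl)) (+-identityʳ _) ⟩
        u i                    <⟨ x<x+y _ 0<η ⟩
        u i + η                ≈⟨ u+η≈ i ⟩
        fromℕ (suc (a i))      ∎)
        where open ≤-Reasoning

    realize : ∃[ z ] ∀ i → Within (a i) (d z (proj₁ (y i)))
    realize = let z , z≈g = katetov c y g (λ i → within⇒0< {a i} (g-within i)) lipschitz subadditive in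
      z , λ i → <-respʳ-≈ (sym (z≈g i)) (proj₁ (g-within i)) , <-respˡ-≈ (sym (z≈g i)) (proj₂ (g-within i))

  -- Distances to the `y i` change by at most `d z w`, which is kept below their gaps to both ends
  -- of the intervals.
  within-open : ∀ {n} (a : Fin n → ℕ) (y : Fin n → Point) {z} → (∀ i → Within (a i) (d z (y i))) →
                ∃[ η ] 0# < η × ∀ w → d z w < η → ∀ i → Within (a i) (d w (y i))
  within-open {n} a y {z} z-within =
    let η , 0<η , close = uniform (λ i δ → ∀ w → d z w < δ → Within (a i) (d w (y i)))
                            (λ i δ′≤δ p w zw<δ′ → p w (<-≤-trans zw<δ′ δ′≤δ)) near (allFin n)
    in η , 0<η , λ w zw<η i → All.lookup close (∈-allFin i) w zw<η
    where
    open ≤-Reasoning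
    near : ∀ i → ∃[ δ ] 0# < δ × ∀ w → d z w < δ → Within (a i) (d w (y i))
    near i with gap (proj₁ (z-within i)) | gap (proj₂ (z-within i))
    ... | δ , 0<δ , p | δ′ , 0<δ′ , q with smaller δ δ′
    ...   | m , m≤δ , m≤δ′ , 0<m = m , 0<m 0<δ 0<δ′ , λ w zw<m →
      +-cancelʳ-< δ (begin-strict
        fromℕ (a i) + δ       <⟨ p ⟩
        d z (y i)             ≤⟨ triangle _ w _ ⟩
        d z w + d w (y i)     ≤⟨ +-monoˡ-≤ _ (≤-trans (<⇒≤ zw<m) m≤δ) ⟩
        δ + d w (y i)         ≈⟨ +-comm δ _ ⟩
        d w (y i) + δ         ∎) ,
      (begin-strict
        d w (y i)             ≤⟨ triangle _ z _ ⟩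
        d w z + d z (y i)     ≈⟨ trans (+-congʳ (d-sym w z)) (+-comm _ _) ⟩
        d z (y i) + d z w     ≤⟨ +-monoʳ-≤ _ (≤-trans (<⇒≤ zw<m) m≤δ′) ⟩
        d z (y i) + δ′        <⟨ q ⟩
        fromℕ (suc (a i))     ∎)

module Compatible (em : ExcludedMiddle 0ℓ) {ℝ : CompleteOrderedField} (𝔘 : MetricSpace ℝ)
  {U₁ U₂ : Pred (MetricSpace.Point 𝔘) 0ℓ} (G₁ : Graph (subsetoid 𝔘 U₁)) (G₂ : Graph (subsetoid 𝔘 U₂)) where

  open OrderedField em ℝ
  open Solver using (solve; _:+_; _:=_)
  open MetricProperties em 𝔘
  open Steps em ℝ

  module G₁ = Graph G₁
  module G₂ = Graph G₂
  module V₁ = Setoid (subsetoid 𝔘 U₁)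
  module V₂ = Setoid (subsetoid 𝔘 U₂)

  _#_ : V₁.Carrier × V₂.Carrier → V₁.Carrier × V₂.Carrier → Set
  (u , v) # (u′ , v′) = Step (dist 𝔘 U₁ u u′) (dist 𝔘 U₂ v v′) × (u G₁.~ u′ ⇔ v G₂.~ v′)

  #-refl : ∀ {p} → p # p
  #-refl {u , v} = inj₁ (≈⇒0 EqP.refl , ≈⇒0 EqP.refl) ,
    mk⇔ (λ u~u → contradiction u~u (G₁.irrefl EqP.refl)) (λ v~v → contradiction v~v (G₂.irrefl EqP.refl))

  #-sym : ∀ {p q} → p # q → q # p
  #-sym (step , adj) = step-resp (d-sym _ _) (d-sym _ _) step ,
    mk⇔ (G₂.sym ∘ Equivalence.to adj ∘ G₁.sym) (G₁.sym ∘ Equivalence.from adj ∘ G₂.sym)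

  #-≈ : ∀ {u v u′ v′} → (u , v) # (u′ , v′) → u V₁.≈ u′ ⇔ v V₂.≈ v′
  #-≈ (step , _) = mk⇔ (0⇒≈ ∘ step-≈0 step ∘ ≈⇒0) (0⇒≈ ∘ step-≈0 (step-sym step) ∘ ≈⇒0)

  module Extension (isUrysohn : IsUrysohn 𝔘) (free₁ : IntegerDistanceFree 𝔘 U₁) (gec₁ : IsGEC 𝔘 U₁ G₁)
    (c₂ : Countable 𝔘 U₂) (dense₂ : Dense 𝔘 U₂) (gec₂ : IsGEC 𝔘 U₂ G₂) where

    open StepRealization em 𝔘 isUrysohn

    module _ {n : ℕ} (x : Fin n → V₁.Carrier) (y : Fin n → V₂.Carrier)
      (coherent : ∀ i j → (x i , y i) # (x j , y j)) (u : V₁.Carrier) where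

      private
        r : Fin n → Carrier
        r i = dist 𝔘 U₁ u (x i)

      module New (u≉x : ∀ i → ¬ u V₁.≈ x i) where

        floors : ∀ i → ∃[ a ] Within a (r i)
        floors i with floor (r i) nonNegative
        ... | a , inj₁ a<r , r<1+a = a , a<r , r<1+a
        ... | a , inj₂ a≈r , r<1+a = contradiction (sym a≈r) (free₁ _ _ (proj₂ u) (proj₂ (x i)) (u≉x i) a)

        a : Fin n → ℕ
        a i = proj₁ (floors i)

        -- The triangle inequality through `u`, with `r i` rounded down and `r k` up, compares
        -- integers with a single distance. Such a comparison passes from the `x` to the `y`.
        lower : ∀ i k → fromℕ (a i) < fromℕ (suc (a k)) + dist 𝔘 U₂ (y k) (y i)
        lower i k = step-preserves-> (a i) (suc (a k)) (proj₁ (coherent k i)) (begin-strict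
          fromℕ (a i)                                    <⟨ proj₁ (proj₂ (floors i)) ⟩
          r i                                            ≤⟨ triangle _ _ _ ⟩
          r k + dist 𝔘 U₁ (x k) (x i)                    <⟨ +-monoˡ-< _ (proj₂ (proj₂ (floors k))) ⟩
          fromℕ (suc (a k)) + dist 𝔘 U₁ (x k) (x i)      ∎)
          where open ≤-Reasoning

        upper : ∀ k m → dist 𝔘 U₂ (y k) (y m) < fromℕ (suc (a k)) + fromℕ (suc (a m))
        upper k m = <-respʳ-≈ (fromℕ-homo-+ (suc (a k)) (suc (a m)))
          (step-preserves-< (suc (a k) ℕ.+ suc (a m)) (proj₁ (coherent k m)) (begin-strict
            dist 𝔘 U₁ (x k) (x m)                   ≤⟨ triangle _ (proj₁ u) _ ⟩
            dist 𝔘 U₁ (x k) u + r m                 ≈⟨ +-congʳ (d-sym _ _) ⟩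
            r k + r m                               <⟨ +-mono-< (proj₂ (proj₂ (floors k))) (proj₂ (proj₂ (floors m))) ⟩
            fromℕ (suc (a k)) + fromℕ (suc (a m))   ≈⟨ fromℕ-homo-+ (suc (a k)) (suc (a m)) ⟨
            fromℕ (suc (a k) ℕ.+ suc (a m))         ∎))
          where open ≤-Reasoning

        target : ∃[ z ] ∃[ η ] 0# < η × ∀ w → d z w < η → ∀ i → Within (a i) (d w (proj₁ (y i)))
        target = let z , z-within = realize c₂ y a lower upper in z , within-open a (proj₁ ∘ y) z-within

        z = proj₁ target
        η = proj₁ (proj₂ target)
        0<η = proj₁ (proj₂ (proj₂ target))

        near-step : ∀ (w : V₂.Carrier) → d z (proj₁ w) < η → ∀ i → Step (r i) (dist 𝔘 U₂ w (y i))
        near-step w zw<η i = inj₂ (a i , proj₂ (floors i) , proj₂ (proj₂ (proj₂ target)) (proj₁ w) zw<η i)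

        -- The extension property must be centred at a vertex, and `z` need not be one. Half of `η`
        -- remains for the distance from `s` to the new vertex.
        s : V₂.Carrier
        s = let s , Us , _ = dense₂ z (η * ½) (0<x*½ 0<η) in s , Us

        zs<η/2 : d z (proj₁ s) < η * ½
        zs<η/2 = proj₂ (proj₂ (dense₂ z (η * ½) (0<x*½ 0<η)))

        -- The adjacency threshold is an integer, so `Step` sees it; `fromℕ 1` is `1# + 0#`.
        <1-transfer : ∀ {x y} → Step x y → x < 1# → y < 1#
        <1-transfer step x<1 = <-respʳ-≈ (+-identityʳ 1#)
          (step-preserves-< 1 step (<-respʳ-≈ (sym (+-identityʳ 1#)) x<1))

        sStep : ∀ i → Step (r i) (dist 𝔘 U₂ s (y i))
        sStep = near-step s (<-trans zs<η/2 (x*½<x 0<η))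

        -- The extension property accepts only points of the unit ball around `s`. For neighbours of
        -- `u` this is automatic by `threshold`; for the others it is imposed.
        InA InB : Fin n → Set
        InA i = u G₁.~ x i
        InB i = ¬ u G₁.~ x i × dist 𝔘 U₂ s (y i) < 1#

        inA? : ∀ i → Dec (InA i)
        inA? _ = em
        inB? : ∀ i → Dec (InB i)
        inB? _ = em

        A B : List V₂.Carrier
        A = map y (filter inA? (allFin n))
        B = map y (filter inB? (allFin n))

        allA : ∀ {P : V₂.Carrier → Set} → (∀ i → InA i → P (y i)) → All P A
        allA p = All.map⁺ (All.map (λ {i} → p i) (All.all-filter inA? (allFin n)))
        allB : ∀ {P : V₂.Carrier → Set} → (∀ i → InB i → P (y i)) → All P B
        allB p = All.map⁺ (All.map (λ {i} → p i) (All.all-filter inB? (allFin n)))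

        atA : ∀ {P : V₂.Carrier → Set} → All P A → ∀ i → InA i → P (y i)
        atA ps i p = All.lookup ps (∈-map⁺ y (∈-filter⁺ inA? (∈-allFin i) p))
        atB : ∀ {P : V₂.Carrier → Set} → All P B → ∀ i → InB i → P (y i)
        atB ps i p = All.lookup ps (∈-map⁺ y (∈-filter⁺ inB? (∈-allFin i) p))

        -- A common point would make some `y i` and `y j` equal, hence also `x i` and `x j`, with
        -- `u` adjacent to only one of them.
        disjoint : ∀ {v} → ¬ (Any (v V₂.≈_) A × Any (v V₂.≈_) B)
        disjoint {v} (v∈A , v∈B) =
          let i , u~xi , v≈yi = fromAny {v = v} (allA (λ i p → i , p , EqP.refl)) v∈A
              j , u≁xj , v≈yj = fromAny {v = v} (allB (λ j p → j , p , EqP.refl)) v∈B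
              xi≈xj = Equivalence.from (#-≈ (coherent i j)) (EqP.trans (EqP.sym v≈yi) v≈yj)
          in contradiction (proj₁ G₁.resp xi≈xj u~xi) (proj₁ u≁xj)
          where
          fromAny : ∀ {P : Fin n → Set} {ys v} → All (λ y′ → ∃[ i ] P i × y′ V₂.≈ y i) ys →
                    Any (v V₂.≈_) ys → ∃[ i ] P i × v V₂.≈ y i
          fromAny ((i , p , y′≈yi) ∷ _) (here v≈y′) = i , p , EqP.trans v≈y′ y′≈yi
          fromAny {v = v} (_ ∷ ps) (there v∈) = fromAny {v = v} ps v∈

        result : ∃[ v ] ∀ i → (u , v) # (x i , y i)
        result =
          let v , _ , _ , sv<η/2 , v~A , v≁B = IsGEC.extension gec₂ s A B (λ {v} → disjoint {v})
                (allA λ i u~x → <1-transfer (sStep i) (IsGEC.threshold gec₁ _ _ u~x))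
                (allB λ i → proj₂) (η * ½) (0<x*½ 0<η)
              vStep = near-step v (<-respʳ-≈ (halves η) (≤-<-trans (triangle _ _ _) (+-mono-< zs<η/2 sv<η/2)))
          -- An edge from `v` to `y i` forces distance below 1 from `v` to `y i`, hence from `u` to
          -- `x i` and from `s` to `y i`. If `u` were not adjacent to `x i`, then `y i` would be in
          -- `B`.
          in v , λ i → vStep i , mk⇔ (atA v~A i) λ v~y → decidable-stable em λ u≁x →
               atB v≁B i (u≁x , <1-transfer (sStep i)
                 (<1-transfer (step-sym (vStep i)) (IsGEC.threshold gec₂ _ _ v~y))) v~y

      extend : ∃[ v ] ∀ i → (u , v) # (x i , y i)
      extend with em {∃[ i ] u V₁.≈ x i}
      ... | no ∄i = New.result (λ i u≈xi → ∄i (i , u≈xi))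
      ... | yes (i , u≈xi) = y i , λ j → let step , adj = coherent i j in
        step-resp (d-cong (EqP.sym u≈xi) EqP.refl) refl step ,
        mk⇔ (Equivalence.to adj ∘ proj₂ G₁.resp u≈xi) (proj₂ G₁.resp (EqP.sym u≈xi) ∘ Equivalence.from adj)

-- Isomorphism of g.e.c. graphs, and the abundance of vertices near a point

module _ (em : ExcludedMiddle 0ℓ) {ℝ : CompleteOrderedField} (𝔘 : MetricSpace ℝ) (isUrysohn : IsUrysohn 𝔘) where

  gec⇒≅ : (U₁ U₂ : Pred (MetricSpace.Point 𝔘) 0ℓ) →
       Countable 𝔘 U₁ → Dense 𝔘 U₁ → IntegerDistanceFree 𝔘 U₁ →
       Countable 𝔘 U₂ → Dense 𝔘 U₂ → IntegerDistanceFree 𝔘 U₂ →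
       (G₁ : Graph (subsetoid 𝔘 U₁)) (G₂ : Graph (subsetoid 𝔘 U₂)) →
       IsGEC 𝔘 U₁ G₁ → IsGEC 𝔘 U₂ G₂ → G₁ ≅ G₂
  gec⇒≅ U₁ U₂ c₁ dense₁ free₁ c₂ dense₂ free₂ G₁ G₂ gec₁ gec₂ =
    isomorphic #-≈ (λ {v} {w} {v′} {w′} → proj₂) forth back
    where
    open Compatible em 𝔘 G₁ G₂
    module Flip = Compatible em 𝔘 G₂ G₁
    open BackAndForth em G₁ G₂ c₁ c₂ _#_ (λ {p} → #-refl {p}) (λ {p} {q} → #-sym {p} {q})
    open Finite
    open Steps em ℝ using (step-sym)

    flip : ∀ {p q} → p # q → swap p Flip.# swap q
    flip (step , adj) = step-sym step , mk⇔ (Equivalence.from adj) (Equivalence.to adj)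

    unflip : ∀ {p q} → p Flip.# q → swap p # swap q
    unflip (step , adj) = step-sym step , mk⇔ (Equivalence.from adj) (Equivalence.to adj)

    forth : ∀ f v → ∃[ w ] ∀ i → (v , w) # pair f i
    forth f = Extension.extend isUrysohn free₁ gec₁ c₂ dense₂ gec₂ (proj₁ ∘ pair f) (proj₂ ∘ pair f) (coherent f)

    back : ∀ f w → ∃[ v ] ∀ i → (v , w) # pair f i
    back f w =
      let v , compatible = Flip.Extension.extend isUrysohn free₂ gec₂ c₁ dense₁ gec₁ (proj₂ ∘ pair f) (proj₁ ∘ pair f)
                             (λ i j → flip {pair f i} {pair f j} (coherent f i j)) w
      in v , λ i → unflip {w , v} (compatible i)

  open OrderedField em ℝ
  open MetricProperties em 𝔘
  open Urysohn em 𝔘 isUrysohn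

  module _ {U : Pred (MetricSpace.Point 𝔘) 0ℓ} (c : Countable 𝔘 U) (dense : Dense 𝔘 U) where

    private
      Vertex : Set
      Vertex = Setoid.Carrier (subsetoid 𝔘 U)
      code : Vertex → ℕ
      code = Injection.to c

    -- A point of U sufficiently close to s, but different from s, differs
    -- from the finitely many points with code below M.
    large-codes : ∀ (s : Vertex) M δ → 0# < δ → ∃[ v ] dist 𝔘 U s v < δ × M ℕ.≤ code v
    large-codes s M δ 0<δ =
      let η₀ , 0<η₀ , avoid = uniform Avoid (λ i δ′≤δ p a ca≡i a≉s → ≤-trans δ′≤δ (p a ca≡i a≉s)) separated (upTo M)
          η , η≤η₀ , η≤δ , 0<η′ = smaller η₀ δ
          0<η = 0<η′ 0<η₀ 0<δ
          0<r = 0<x*½ 0<η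
          0<ρ = 0<x*½ 0<r
          -- A one-point Katětov function gives `z` at distance exactly `η / 2` from `s`. A point
          -- within `η / 4` of `z` then differs from `s` and is closer to `s` than `η`.
          z , zs≈r = katetov c {n = 1} (λ _ → s) (λ _ → η * ½) (λ _ → 0<r)
                       (λ _ _ → ≤-reflexive (sym (trans (+-congˡ (≈⇒0 EqP.refl)) (+-identityʳ _))))
                       (λ _ _ → ≤-trans (≤-reflexive (≈⇒0 EqP.refl)) (+-nonneg (<⇒≤ 0<r) (<⇒≤ 0<r)))
          v , Uv , zv<ρ = dense z (η * ½ * ½) 0<ρ
      in (v , Uv) , finish (halves η) (halves (η * ½)) 0<ρ η≤δ
           (λ a ca<M a≉s → ≤-trans η≤η₀ (All.lookup avoid (∈-upTo⁺ ca<M) a ≡.refl a≉s)) (zs≈r zero) (v , Uv) zv<ρ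
      where
      open ≤-Reasoning
      finish : ∀ {η r ρ} → r + r ≈ η → ρ + ρ ≈ r → 0# < ρ → η ≤ δ →
               (∀ a → code a ℕ.< M → ¬ proj₁ a ≈ₚ proj₁ s → η ≤ dist 𝔘 U s a) →
               ∀ {z} → d z (proj₁ s) ≈ r → ∀ v → d z (proj₁ v) < ρ → dist 𝔘 U s v < δ × M ℕ.≤ code v
      finish {η} {r} {ρ} 2r≈η 2ρ≈r 0<ρ η≤δ avoid {z} zs≈r v zv<ρ =
        <-≤-trans sv<η η≤δ , ℕ.≮⇒≥ λ cv<M → ≤⇒≯ (avoid v cv<M (0<d⇒≉ 0<vs)) sv<η
        where
        ρ<r : ρ < r
        ρ<r = <-respʳ-≈ 2ρ≈r (x<x+y ρ 0<ρ)
        sv<η : dist 𝔘 U s v < η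
        sv<η = begin-strict
          dist 𝔘 U s v                  ≤⟨ triangle _ z _ ⟩
          d (proj₁ s) z + d z (proj₁ v) ≈⟨ +-congʳ (trans (d-sym _ _) zs≈r) ⟩
          r + d z (proj₁ v)             <⟨ +-monoʳ-< r (<-trans zv<ρ ρ<r) ⟩
          r + r                         ≈⟨ 2r≈η ⟩
          η                             ∎
        0<vs : 0# < dist 𝔘 U v s
        0<vs = +-cancelʳ-< ρ (begin-strict
          0# + ρ                        ≈⟨ +-identityˡ ρ ⟩
          ρ                             <⟨ ρ<r ⟩
          r                             ≈⟨ zs≈r ⟨
          d z (proj₁ s)                 ≤⟨ triangle _ (proj₁ v) _ ⟩
          d z (proj₁ v) + dist 𝔘 U v s  ≤⟨ +-monoˡ-≤ _ (<⇒≤ zv<ρ) ⟩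
          ρ + dist 𝔘 U v s              ≈⟨ +-comm ρ _ ⟩
          dist 𝔘 U v s + ρ              ∎)
      Avoid : ℕ → Carrier → Set
      Avoid i δ = ∀ (a : Vertex) → code a ≡ i → ¬ proj₁ a ≈ₚ proj₁ s → δ ≤ dist 𝔘 U s a
      -- Codes are injective, so at most one point has code `i`, and its distance from `s` serves.
      separated : ∀ i → ∃[ δ ] 0# < δ × Avoid i δ
      separated i with em {∃[ a ] code a ≡ i × ¬ proj₁ a ≈ₚ proj₁ s}
      ... | no ∄a = 1# , 0<1 , λ a ca≡i a≉s → contradiction (a , ca≡i , a≉s) ∄a
      ... | yes (a , ca≡i , a≉s) = dist 𝔘 U s a , ≉⇒0<d (a≉s ∘ EqP.sym) , λ b cb≡i _ →
        ≤-reflexive (d-cong EqP.refl (Injection.injective c (≡.trans ca≡i (≡.sym cb≡i))))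

-- Null sets

Unique-resp-⊆ : ∀ {A : Set} {xs ys : List A} → xs ⊆ ys → Unique ys → Unique xs
Unique-resp-⊆ []            _            = []
Unique-resp-⊆ (_ ∷ʳ xs⊆ys)  (_ ∷ ys!)    = Unique-resp-⊆ xs⊆ys ys!
Unique-resp-⊆ (≡.refl ∷ xs⊆ys) (y∉ys ∷ ys!) = Sublist.All-resp-⊆ xs⊆ys y∉ys ∷ Unique-resp-⊆ xs⊆ys ys!

module _ {A : Set} where

  -- Concatenates countably many lists. The `nothing` after each list makes every call consume an
  -- index, even at an empty list.
  flatten : List A → (ℕ → List A) → ℕ → Maybe A
  flatten (x ∷ xs) xss zero    = just x
  flatten (x ∷ xs) xss (suc k) = flatten xs xss k
  flatten []       xss zero    = nothing
  flatten []       xss (suc k) = flatten (xss zero) (xss ∘ suc) k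

  flatten-here : ∀ {P : A → Set} {xs} xss → Any P xs → ∃[ k ] Maybe.Any P (flatten xs xss k)
  flatten-here xss (here p)  = 0 , Maybe.just p
  flatten-here xss (there p) = let k , q = flatten-here xss p in suc k , q

  flatten-there : ∀ {P : A → Set} xs xss i → Any P (xss i) → ∃[ k ] Maybe.Any P (flatten xs xss k)
  flatten-there []       xss zero    p = let k , q = flatten-here (xss ∘ suc) p in suc k , q
  flatten-there []       xss (suc i) p = let k , q = flatten-there (xss zero) (xss ∘ suc) i p in suc k , q
  flatten-there (x ∷ xs) xss i       p = let k , q = flatten-there xs xss i p in suc k , q

module Blocks {I : Set} where

  Block : Set
  Block = List (I × Bool)

  Matches : (I → Bool) → Block → Set
  Matches ω = All (λ (i , b) → ω i ≡ b)

  coins : Block → List I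
  coins = map proj₁

  -- A word differs from B at a first position: the complement of a cylinder
  -- is a disjoint union of cylinders.
  mismatches : Block → List Block
  mismatches []            = []
  mismatches ((i , b) ∷ B) = ((i , not b) ∷ []) ∷ map ((i , b) ∷_) (mismatches B)

  avoiding : List Block → List Block
  avoiding []       = [] ∷ []
  avoiding (B ∷ Bs) = cartesianProductWith _++_ (mismatches B) (avoiding Bs)

  mismatches-covers : ∀ ω B → ¬ Matches ω B → Any (Matches ω) (mismatches B)
  mismatches-covers ω []            ¬m = contradiction [] ¬m
  mismatches-covers ω ((i , b) ∷ B) ¬m with ω i Bool.≟ b
  ... | yes ωi≡b = there (Any.map⁺ (Any.map (ωi≡b ∷_) (mismatches-covers ω B (¬m ∘ (ωi≡b ∷_)))))
  ... | no  ωi≢b = here (Bool.¬-not ωi≢b ∷ [])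

  avoiding-covers : ∀ ω Bs → All (¬_ ∘ Matches ω) Bs → Any (Matches ω) (avoiding Bs)
  avoiding-covers ω []       []         = here []
  avoiding-covers ω (B ∷ Bs) (¬m ∷ ¬ms) =
    Any.cartesianProductWith⁺ _++_ All.++⁺ (mismatches-covers ω B ¬m) (avoiding-covers ω Bs ¬ms)

  mismatches-coins : ∀ B → All (λ C → coins C ⊆ coins B) (mismatches B)
  mismatches-coins []            = []
  mismatches-coins ((i , b) ∷ B) =
    (≡.refl ∷ minimum _) ∷ All.map⁺ (All.map (≡.refl ∷_) (mismatches-coins B))

  -- A cylinder may not repeat a coin; as sublists, the words inherit distinctness from the
  -- concatenated blocks.
  avoiding-coins : ∀ Bs → All (λ C → coins C ⊆ coins (concat Bs)) (avoiding Bs)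
  avoiding-coins []       = [] ∷ []
  avoiding-coins (B ∷ Bs) = All.cartesianProductWith⁺ (≡.setoid _) (≡.setoid _) _++_ (mismatches B) (avoiding Bs)
    λ {C} {D} C∈ D∈ → ≡.subst₂ _⊆_ (≡.sym (map-++ proj₁ C D)) (≡.sym (map-++ proj₁ B (concat Bs)))
      (Sublist.++⁺ (All.lookup (mismatches-coins B) C∈) (All.lookup (avoiding-coins Bs) D∈))

  cylinders : ∀ {Bs} → All (Unique ∘ coins) Bs → List (Cylinder I)
  cylinders = All.reduce λ {B} B! → record { constraints = B ; distinct = B! }

  cylinders-cover : ∀ {ω Bs} (Bs! : All (Unique ∘ coins) Bs) → Any (Matches ω) Bs → Any (ω ∈ᶜ_) (cylinders Bs!)
  cylinders-cover (_ ∷ _)   (here m)  = here m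
  cylinders-cover (_ ∷ Bs!) (there m) = there (cylinders-cover Bs! m)

-- The product measure of independent coins

module Probability (em : ExcludedMiddle 0ℓ) (ℝ : CompleteOrderedField)
  (p : CompleteOrderedField.Carrier ℝ)
  (0<p : CompleteOrderedField._<_ ℝ (CompleteOrderedField.0# ℝ) p)
  (p<1 : CompleteOrderedField._<_ ℝ p (CompleteOrderedField.1# ℝ))
  where

  open OrderedField em ℝ
  open Solver using (solve; _:+_; _:*_; _:=_)

  sum-++ : ∀ xs ys → sum (xs ++ ys) ≈ sum xs + sum ys
  sum-++ []       ys = sym (+-identityˡ _)
  sum-++ (x ∷ xs) ys = trans (+-congˡ (sum-++ xs ys)) (sym (+-assoc _ _ _))

  sum-nonneg : ∀ {xs} → All (0# ≤_) xs → 0# ≤ sum xs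
  sum-nonneg []       = ≤-refl
  sum-nonneg (p ∷ ps) = +-nonneg p (sum-nonneg ps)

  product-++ : ∀ xs ys → product (xs ++ ys) ≈ product xs * product ys
  product-++ []       ys = sym (*-identityˡ _)
  product-++ (x ∷ xs) ys = trans (*-congˡ (product-++ xs ys)) (sym (*-assoc _ _ _))

  product-positive : ∀ {xs} → All (0# <_) xs → 0# < product xs
  product-positive []       = 0<1
  product-positive (p ∷ ps) = *-positive p (product-positive ps)

  weight : Bool → Carrier
  weight b = if b then p else 1# - p

  weight-positive : ∀ b → 0# < weight b
  weight-positive true  = 0<p
  weight-positive false = <-respˡ-≈ (-‿inverseʳ p) (+-monoˡ-< (- p) p<1)

  weight-not : ∀ b → weight (not b) + weight b ≈ 1#
  weight-not true  = x-y+y≈x 1# p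
  weight-not false = trans (+-comm _ _) (x-y+y≈x 1# p)

  module _ {I : Set} where

    open Blocks {I}

    μ : Block → Carrier
    μ B = product (map (λ (_ , b) → weight b) B)

    total : List Block → Carrier
    total Bs = sum (map μ Bs)

    μ-positive : ∀ B → 0# < μ B
    μ-positive B = product-positive (All.map⁺ (All.universal (λ (_ , b) → weight-positive b) B))

    total-nonneg : ∀ Bs → 0# ≤ total Bs
    total-nonneg Bs = sum-nonneg (All.map⁺ (All.universal (<⇒≤ ∘ μ-positive) Bs))

    μ-++ : ∀ B C → μ (B ++ C) ≈ μ B * μ C
    μ-++ B C = trans (reflexive (≡.cong product (map-++ _ B C))) (product-++ (map _ B) (map _ C))

    total-++ : ∀ Bs Cs → total (Bs ++ Cs) ≈ total Bs + total Cs
    total-++ Bs Cs = trans (reflexive (≡.cong sum (map-++ μ Bs Cs))) (sum-++ (map μ Bs) (map μ Cs))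

    total-map-++ : ∀ B Cs → total (map (B ++_) Cs) ≈ μ B * total Cs
    total-map-++ B []       = sym (zeroʳ _)
    total-map-++ B (C ∷ Cs) = trans (+-cong (μ-++ B C) (total-map-++ B Cs)) (sym (distribˡ _ _ _))

    total-product : ∀ Bs Cs → total (cartesianProductWith _++_ Bs Cs) ≈ total Bs * total Cs
    total-product []       Cs = sym (zeroˡ _)
    total-product (B ∷ Bs) Cs = trans (total-++ (map (B ++_) Cs) _)
      (trans (+-cong (total-map-++ B Cs) (total-product Bs Cs)) (sym (distribʳ _ _ _)))

    -- For distinct coins, a block and its mismatches partition the outcomes. The induction splits
    -- on the first coin.
    total-mismatches : ∀ B → total (mismatches B) + μ B ≈ 1#
    total-mismatches []            = +-identityˡ 1#
    total-mismatches ((i , b) ∷ B) = begin-equality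
      (weight (not b) * 1# + total (map ((i , b) ∷_) (mismatches B))) + weight b * μ B
        ≈⟨ +-congʳ (+-cong (*-identityʳ _)
             (trans (total-map-++ ((i , b) ∷ []) (mismatches B)) (*-congʳ (*-identityʳ _)))) ⟩
      (weight (not b) + weight b * total (mismatches B)) + weight b * μ B
        ≈⟨ solve 4 (λ n w t m → (n :+ w :* t) :+ w :* m := n :+ w :* (t :+ m))
             refl (weight (not b)) (weight b) (total (mismatches B)) (μ B) ⟩
      weight (not b) + weight b * (total (mismatches B) + μ B)
        ≈⟨ +-congˡ (trans (*-congˡ (total-mismatches B)) (*-identityʳ _)) ⟩
      weight (not b) + weight b
        ≈⟨ weight-not b ⟩
      1# ∎
      where open ≤-Reasoning

    -- Independence: `μ` turns concatenation into multiplication, so the totals multiply, and each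
    -- factor is the probability `t` of missing a block of measure `q`.
    total-avoiding : ∀ {t q} Bs → t + q ≈ 1# → All (λ B → μ B ≈ q) Bs → total (avoiding Bs) ≈ t ^ length Bs
    total-avoiding []       t+q≈1 []           = +-identityʳ 1#
    total-avoiding {t} {q} (B ∷ Bs) t+q≈1 (μB≈q ∷ eqs) = trans (total-product (mismatches B) (avoiding Bs))
      (*-cong (+-cancelʳ-≈ q (trans (+-congˡ (sym μB≈q)) (trans (total-mismatches B) (sym t+q≈1))))
              (total-avoiding Bs t+q≈1 eqs))

    measures : List (Cylinder I) → Carrier
    measures L = sum (map (measure ℝ p) L)

    measures-cylinders : ∀ {Bs} (Bs! : All (Unique ∘ coins) Bs) → measures (cylinders Bs!) ≡ total Bs
    measures-cylinders []         = ≡.refl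
    measures-cylinders (B! ∷ Bs!) = ≡.cong (_ +_) (measures-cylinders Bs!)

    measure-nonneg : ∀ (C : Cylinder I) → 0# ≤ measure ℝ p C
    measure-nonneg C = <⇒≤ (μ-positive (Cylinder.constraints C))

    measures-nonneg : ∀ (L : List (Cylinder I)) → 0# ≤ measures L
    measures-nonneg L = sum-nonneg (All.map⁺ (All.universal measure-nonneg L))

    -- Outer Jordan content zero. Finite covers of single events can be strung together by
    -- `flatten`.
    FinitelyNull : Pred (I → Bool) 0ℓ → Set
    FinitelyNull N = ∀ ε → 0# < ε → ∃[ L ] (∀ ω → N ω → Any (ω ∈ᶜ_) L) × measures L ≤ ε

    -- Each list takes up at least one index, that of its `nothing`, so the first `n` entries reach
    -- no further than `L` and the first `n` of the `Ls`.
    flatten-measure : ∀ {m n} L Ls → n ℕ.≤ m →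
      sum (applyUpTo (λ k → maybe′ (measure ℝ p) 0# (flatten L Ls k)) n)
        ≤ measures L + sum (applyUpTo (measures ∘ Ls) m)
    flatten-measure {m} {zero} L Ls _ = +-nonneg (measures-nonneg L)
      (sum-nonneg (All.applyUpTo⁺₂ (measures ∘ Ls) m (measures-nonneg ∘ Ls)))
    flatten-measure {m} {suc n} (C ∷ L) Ls n<m =
      ≤-trans (+-monoʳ-≤ _ (flatten-measure L Ls (ℕ.<⇒≤ n<m))) (≤-reflexive (sym (+-assoc _ _ _)))
    flatten-measure {suc m} {suc n} [] Ls (ℕ.s≤s n≤m) =
      +-monoʳ-≤ 0# (flatten-measure (Ls zero) (Ls ∘ suc) n≤m)

    -- This is `ε / 2 ^ suc i`. Halving the argument makes the tail of the sequence the shares of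
    -- `ε * ½`, as the induction in `sum-shares` requires.
    share : Carrier → ℕ → Carrier
    share ε zero    = ε * ½
    share ε (suc i) = share (ε * ½) i

    share-positive : ∀ {ε} → 0# < ε → ∀ i → 0# < share ε i
    share-positive 0<ε zero    = 0<x*½ 0<ε
    share-positive 0<ε (suc i) = share-positive (0<x*½ 0<ε) i

    sum-shares : ∀ {ε} f n → 0# < ε → (∀ i → f i ≤ share ε i) → sum (applyUpTo f n) ≤ ε
    sum-shares f zero    0<ε f≤ = <⇒≤ 0<ε
    sum-shares f (suc n) 0<ε f≤ = ≤-trans
      (+-mono-≤ (f≤ 0) (sum-shares (f ∘ suc) n (0<x*½ 0<ε) (f≤ ∘ suc))) (≤-reflexive (halves _))

    null-⋃ : ∀ (N : ℕ → Pred (I → Bool) 0ℓ) → (∀ n → FinitelyNull (N n)) → Null ℝ p (λ ω → ∃[ n ] N n ω)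
    null-⋃ N null ε 0<ε = flatten [] L
      , (λ ω (n , ω∈N) → flatten-there [] L n (proj₁ (proj₂ (cover n)) ω ω∈N))
      , λ n → ≤-trans (flatten-measure {n} {n} [] L ℕ.≤-refl) (≤-trans (≤-reflexive (+-identityˡ _))
          (sum-shares (measures ∘ L) n 0<ε (λ i → proj₂ (proj₂ (cover i)))))
      where
      cover : ∀ n → ∃[ L ] (∀ ω → N n ω → Any (ω ∈ᶜ_) L) × measures L ≤ share ε n
      cover n = null n (share ε n) (share-positive 0<ε n)
      L : ℕ → List (Cylinder I)
      L n = proj₁ (cover n)

-- Random graphs

-- A binary numeral read as a finitely supported sequence: 2[1+_] prepends 0,
-- 1+[2_] increments the head.
entry : ℕᵇ → ℕ → ℕ
entry ℕᵇ.zero  i       = 0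
entry 2[1+ x ] zero    = 0
entry 2[1+ x ] (suc i) = entry x i
entry 1+[2 x ] zero    = suc (entry x zero)
entry 1+[2 x ] (suc i) = entry x (suc i)

-- Lets one number encode any finite tuple, so that the events can be enumerated. `bump x k`
-- prepends `k` to the sequence of `x`.
interpolate : ∀ (f : ℕ → ℕ) N → ∃[ x ] ∀ i → i ℕ.< N → entry x i ≡ f i
interpolate f zero    = ℕᵇ.zero , λ i ()
interpolate f (suc N) = let x , x≡f = interpolate (f ∘ suc) N in bump x (f 0) ,
  λ { zero _ → bump-zero x (f 0) ; (suc i) (ℕ.s≤s i<N) → ≡.trans (bump-suc x (f 0) i) (x≡f i i<N) }
  where
  bump : ℕᵇ → ℕ → ℕᵇ
  bump x zero    = 2[1+ x ]
  bump x (suc k) = 1+[2 bump x k ]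
  bump-zero : ∀ x k → entry (bump x k) 0 ≡ k
  bump-zero x zero    = ≡.refl
  bump-zero x (suc k) = ≡.cong suc (bump-zero x k)
  bump-suc : ∀ x k i → entry (bump x k) (suc i) ≡ entry x i
  bump-suc x zero    i = ≡.refl
  bump-suc x (suc k) i = bump-suc x k i

increasing⇒< : ∀ (f : ℕ → ℕ) → (∀ n → f n ℕ.< f (suc n)) → ∀ {m n} → m ℕ.<′ n → f m ℕ.< f n
increasing⇒< f f< (ℕ.≤′-reflexive ≡.refl) = f< _
increasing⇒< f f< (ℕ.≤′-step m<n)         = ℕ.<-trans (increasing⇒< f f< m<n) (f< _)

module RandomGraph (em : ExcludedMiddle 0ℓ) {ℝ : CompleteOrderedField} (𝔘 : MetricSpace ℝ) (isUrysohn : IsUrysohn 𝔘)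
  (U : Pred (MetricSpace.Point 𝔘) 0ℓ) (c : Countable 𝔘 U) (dense : Dense 𝔘 U)
  (p : CompleteOrderedField.Carrier ℝ)
  (0<p : CompleteOrderedField._<_ ℝ (CompleteOrderedField.0# ℝ) p)
  (p<1 : CompleteOrderedField._<_ ℝ p (CompleteOrderedField.1# ℝ))
  where

  open OrderedField em ℝ
  open MetricProperties em 𝔘
  open Probability em ℝ p 0<p p<1
  open Blocks {Fin 2 × ℕ × ℕ}

  private
    module U = Setoid (subsetoid 𝔘 U)
    module c = Injection c

    δ : U.Carrier → U.Carrier → Carrier
    δ = dist 𝔘 U

  -- If `j ≥ N` is the code of `v`, these are the coins for the pairs of `v` with vertices of codes
  -- `i < N`, since `i` is the minimum and `j` the maximum. Different `j` use different coins.
  block : Fin 2 → ℕ → (ℕ → Bool) → ℕ → Block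
  block g N ℓ j = map (λ i → (g , i , j) , ℓ i) (upTo N)

  -- Centre, radius and finite sets are replaced by a code, an exponent and labels of the codes
  -- below `N`, which leaves countably many events.
  Bad : Fin 2 → ℕ → ℕ → ℕ → (ℕ → Bool) → Pred (Fin 2 × ℕ × ℕ → Bool) 0ℓ
  Bad g s k N ℓ ω = ∃[ σ ] c.to σ ≡ s ×
    (∀ v → δ σ v < ½ ^ k → N ℕ.≤ c.to v → ¬ Matches ω (block g N ℓ (c.to v)))

  blocks-coins : ∀ g N ℓ js → coins (concat (map (block g N ℓ) js)) ≡
                 cartesianProductWith (λ j i → g , i , j) js (upTo N)
  blocks-coins g N ℓ []       = ≡.refl
  blocks-coins g N ℓ (j ∷ js) = ≡.trans (map-++ proj₁ (block g N ℓ j) _)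
    (≡.cong₂ _++_ (≡.sym (map-∘ (upTo N))) (blocks-coins g N ℓ js))

  blocks-unique : ∀ g N ℓ {js} → Unique js → Unique (coins (concat (map (block g N ℓ) js)))
  blocks-unique g N ℓ {js} js! = ≡.subst Unique (≡.sym (blocks-coins g N ℓ js))
    (Unique.cartesianProductWith⁺ (λ j i → g , i , j) (λ { ≡.refl → ≡.refl , ≡.refl }) js! (Unique.upTo⁺ N))

  block-measure : ∀ g N ℓ j → μ (block g N ℓ j) ≡ product (map (weight ∘ ℓ) (upTo N))
  block-measure g N ℓ j = ≡.cong product (≡.sym (map-∘ (upTo N)))

  module _ (g : Fin 2) (σ : U.Carrier) (k N : ℕ) (ℓ : ℕ → Bool) where

    0<½^k : ∀ k → 0# < ½ ^ k
    0<½^k zero    = 0<1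
    0<½^k (suc k) = *-positive 0<½ (0<½^k k)

    point : ℕ → ∃[ v ] δ σ v < ½ ^ k × N ℕ.≤ c.to v
    next : ∀ n → ∃[ w ] δ σ w < ½ ^ k × suc (c.to (proj₁ (point n))) ℕ.≤ c.to w

    point zero    = large-codes em 𝔘 isUrysohn c dense σ N (½ ^ k) (0<½^k k)
    point (suc n) = let w , near , v<w = next n in w , near ,
      ℕ.≤-trans (proj₂ (proj₂ (point n))) (ℕ.<⇒≤ v<w)

    next n = large-codes em 𝔘 isUrysohn c dense σ _ (½ ^ k) (0<½^k k)

    index : ℕ → ℕ
    index n = c.to (proj₁ (point n))

    indices-unique : ∀ m → Unique (applyUpTo index m)
    indices-unique m = Unique.applyUpTo⁺₁ index m λ i<j _ →
      ℕ.<⇒≢ (increasing⇒< index (λ n → proj₂ (proj₂ (next n))) (ℕ.<⇒<′ i<j))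

    -- Vertices near `σ` with different codes have blocks on disjoint coins, all of the same measure
    -- `q`. The first `m` of them all fail with probability `(1 - q) ^ m`, which is small for large
    -- `m`.
    cover : ∀ ε → 0# < ε → ∃[ L ]
      (∀ ω → (∀ v → δ σ v < ½ ^ k → N ℕ.≤ c.to v → ¬ Matches ω (block g N ℓ (c.to v))) → Any (ω ∈ᶜ_) L) ×
      measures L ≤ ε
    cover ε 0<ε =
      -- The index 0 stands for any other: by `block-measure` the measure depends only on `ℓ` and
      -- `N`.
      let q = μ (block g N ℓ 0)
          t = total (mismatches (block g N ℓ 0))
          t+q≈1 = total-mismatches (block g N ℓ 0)
          m , t^m<ε = ^-small (total-nonneg (mismatches (block g N ℓ 0))) (μ-positive (block g N ℓ 0)) t+q≈1 0<ε
          js = applyUpTo index m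
          Bs = map (block g N ℓ) js
          Bs! = All.map (λ C⊆ → Unique-resp-⊆ C⊆ (blocks-unique g N ℓ (indices-unique m))) (avoiding-coins Bs)
          μBs = All.map⁺ (All.universal (λ j → reflexive (≡.trans (block-measure g N ℓ j)
                  (≡.sym (block-measure g N ℓ 0)))) js)
          length≡m = ≡.trans (length-map (block g N ℓ) js) (length-applyUpTo index m)
      in cylinders Bs!
         , (λ ω bad → cylinders-cover Bs! (avoiding-covers ω Bs (All.map⁺ (All.applyUpTo⁺₂ index m
             (λ n → let v , near , N≤v = point n in bad v near N≤v)))))
         , ≤-trans (≤-reflexive (trans (reflexive (measures-cylinders Bs!)) (total-avoiding Bs t+q≈1 μBs)))
             (<⇒≤ (<-respˡ-≈ (reflexive (≡.cong (t ^_) (≡.sym length≡m))) t^m<ε))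

  bad-null : ∀ g s k N ℓ → FinitelyNull (Bad g s k N ℓ)
  bad-null g s k N ℓ ε 0<ε with em {∃[ σ ] c.to σ ≡ s}
  ... | no ∄σ = [] , (λ ω (σ , eq , _) → contradiction (σ , eq) ∄σ) , <⇒≤ 0<ε
  ... | yes (σ , eq) = let L , covers , small = cover g σ k N ℓ ε 0<ε in
    L , (λ ω (σ′ , eq′ , bad) → covers ω λ v near → bad v
          (<-respˡ-≈ (d-cong (c.injective (≡.trans eq (≡.sym eq′))) EqP.refl) near)) , small

  side : ℕ → Fin 2
  side zero    = zero
  side (suc _) = suc zero

  isZero : ℕ → Bool
  isZero zero    = true
  isZero (suc _) = false

  event : ℕ → Pred (Fin 2 × ℕ × ℕ → Bool) 0ℓ
  event n = Bad (side (f 0)) (f 1) (f 2) (f 3) (λ i → isZero (f (4 ℕ.+ i)))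
    where f = entry (ℕᵇ.fromℕ n)

  event-null : ∀ n → FinitelyNull (event n)
  event-null n = bad-null (side (f 0)) (f 1) (f 2) (f 3) (λ i → isZero (f (4 ℕ.+ i)))
    where f = entry (ℕᵇ.fromℕ n)

  -- `interpolate` yields an `event` with the given parameters, but controls its labels only below
  -- `N`; hence the existential `ℓ`.
  event-attains : ∀ {ω} → (∀ n → ¬ event n ω) → ∀ g s k N (label : ℕ → Bool) →
    ∃[ ℓ ] (∀ i → i ℕ.< N → ℓ i ≡ label i) × ¬ Bad g s k N ℓ ω
  event-attains {ω} good g s k N label =
    let x , x≡f = interpolate f (4 ℕ.+ N)
        n≡x = ℕᵇ.fromℕ-toℕ x
        f≡ = λ i i< → ≡.trans (≡.cong (λ x → entry x i) n≡x) (x≡f i i<)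
    in _ , (λ i i<N → ≡.trans (≡.cong isZero (f≡ (4 ℕ.+ i) (ℕ.+-monoʳ-< 4 i<N))) (isZero-bit (label i)))
         , transport (≡.trans (≡.cong side (f≡ 0 ℕ.z<s)) (side-toℕ g)) (f≡ 1 (ℕ.s<s ℕ.z<s))
             (f≡ 2 (ℕ.s<s (ℕ.s<s ℕ.z<s))) (f≡ 3 (ℕ.s<s (ℕ.s<s (ℕ.s<s ℕ.z<s)))) (good (ℕᵇ.toℕ x))
    where
    bit : Bool → ℕ
    bit true  = 0
    bit false = 1
    isZero-bit : ∀ b → isZero (bit b) ≡ b
    isZero-bit true  = ≡.refl
    isZero-bit false = ≡.refl
    side-toℕ : ∀ g → side (toℕ g) ≡ g
    side-toℕ zero       = ≡.refl
    side-toℕ (suc zero) = ≡.refl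
    f : ℕ → ℕ
    f 0 = toℕ g
    f 1 = s
    f 2 = k
    f 3 = N
    f (suc (suc (suc (suc i)))) = bit (label i)
    transport : ∀ {g′ s′ k′ N′ ℓ} → g′ ≡ g → s′ ≡ s → k′ ≡ k → N′ ≡ N → ¬ Bad g′ s′ k′ N′ ℓ ω → ¬ Bad g s k N ℓ ω
    transport ≡.refl ≡.refl ≡.refl ≡.refl ¬bad = ¬bad

  good⇒gec : ∀ {ω} → (∀ n → ¬ event n ω) → ∀ g → IsGEC 𝔘 U (randomGraph 𝔘 U c (λ e → ω (g , e)))
  good⇒gec {ω} good g = record
    { threshold = λ u v (_ , near , _) → near
    ; extension = λ s A B disjoint A-near B-near ε 0<ε →
        -- `η` is a margin by which `A` lies inside the unit ball, so a vertex within `η` of `s`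
        -- stays at distance below 1 from `A`.
        let η , 0<η , close = uniform (λ a δ′ → δ s a < 1# → δ s a + δ′ < 1#)
                                (λ a δ″≤δ′ q near → ≤-<-trans (+-monoʳ-≤ _ δ″≤δ′) (q near)) (room s) A
            r , r≤η , r≤ε , 0<r = smaller η ε
            k , ½^k<r = ^-small (<⇒≤ 0<½) 0<½ ½+½≈1 (0<r 0<η 0<ε)
            codes = map c.to (A ++ B)
            -- A vertex `v` with code at least `N` is outside `A` and `B`, and its coins with their
            -- vertices all belong to its block.
            N = suc (max 0 codes)
            bounded = All.map (λ {a} → ℕ.s≤s {c.to a}) (All.map⁻ {f = c.to} (xs≤max 0 codes))
            A<N = All.++⁻ˡ A bounded
            B<N = All.++⁻ʳ A bounded
            -- Heads exactly at the codes of `A`; on `B` this means tails, by disjointness and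
            -- injectivity of the codes.
            label = λ i → does (em {Any (λ a → c.to a ≡ i) A})
            ℓ , ℓ≡label , ¬bad = event-attains good g (c.to s) k N label
            v , sv<½^k , N≤v , matches = found {s} {k} {N} {ℓ} ¬bad
            coin≡label = λ (a : U.Carrier) (a<N : c.to a ℕ.< N) →
              coin-value {v} {a} {N} {ℓ} matches N≤v a<N (ℓ≡label (c.to a) a<N)
            v∉ = λ {a : U.Carrier} (a<N : c.to a ℕ.< N) (v≈a : v U.≈ a) →
              ℕ.<⇒≱ a<N (≡.subst (N ℕ.≤_) (c.cong v≈a) N≤v)
        in v
         , (λ v∈A → All.lookupWith (λ {a} a<N v≈a → v∉ {a} a<N v≈a) A<N v∈A)
         , (λ v∈B → All.lookupWith (λ {b} b<N v≈b → v∉ {b} b<N v≈b) B<N v∈B)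
         , <-≤-trans sv<½^k (≤-trans (<⇒≤ ½^k<r) r≤ε)
         , All.tabulate (λ {a} a∈A →
             v∉ {a} (All.lookup A<N a∈A)
             , near-v s v a (<-≤-trans sv<½^k (≤-trans (<⇒≤ ½^k<r) r≤η))
                 (All.lookup close a∈A (All.lookup A-near a∈A))
             , ≡.trans (coin≡label a (All.lookup A<N a∈A)) (dec-true em (Any.map (λ { ≡.refl → ≡.refl }) a∈A)))
         , All.tabulate (λ {b} b∈B (_ , _ , heads) → contradiction
             (≡.trans (≡.sym heads) (≡.trans (coin≡label b (All.lookup B<N b∈B)) (dec-false em λ b∈A →
               disjoint {b} (Any.map (λ {a} eq → c.injective (≡.sym eq)) b∈A ,
                             Any.map (λ { ≡.refl → EqP.refl }) b∈B))))
             λ ())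
    }
    where
    ω′ : ℕ × ℕ → Bool
    ω′ e = ω (g , e)

    room : ∀ s a → ∃[ δ′ ] 0# < δ′ × (δ s a < 1# → δ s a + δ′ < 1#)
    room s a with em {δ s a < 1#}
    ... | yes near = let δ′ , 0<δ′ , q = gap near in δ′ , 0<δ′ , λ _ → q
    ... | no ¬near = 1# , 0<1 , λ near → contradiction near ¬near

    near-v : ∀ s v a {η} → δ s v < η → δ s a + η < 1# → δ v a < 1#
    near-v s v a {η} sv<η sa+η<1 = begin-strict
      δ v a            ≤⟨ triangle _ (proj₁ s) _ ⟩
      δ v s + δ s a    ≈⟨ trans (+-comm _ _) (+-congˡ (d-sym _ _)) ⟩
      δ s a + δ s v    <⟨ +-monoʳ-< _ sv<η ⟩
      δ s a + η        <⟨ sa+η<1 ⟩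
      1#               ∎
      where open ≤-Reasoning

    found : ∀ {s k N ℓ} → ¬ Bad g (c.to s) k N ℓ ω →
            ∃[ v ] δ s v < ½ ^ k × N ℕ.≤ c.to v × Matches ω (block g N ℓ (c.to v))
    found {s} ¬bad = decidable-stable em λ ∄v → ¬bad (s , ≡.refl , λ v near N≤v m → ∄v (v , near , N≤v , m))

    coin-value : ∀ {v a N ℓ b} → Matches ω (block g N ℓ (c.to v)) → N ℕ.≤ c.to v → c.to a ℕ.< N → ℓ (c.to a) ≡ b →
                 coin 𝔘 U c ω′ v a ≡ b
    coin-value {v} {a} matches N≤v a<N ℓa≡b = ≡.trans
      (≡.cong₂ (λ i j → ω′ (i , j)) (ℕ.m≥n⇒m⊓n≡n a≤v) (ℕ.m≥n⇒m⊔n≡m a≤v))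
      (≡.trans (All.lookup (All.map⁻ matches) (∈-upTo⁺ a<N)) ℓa≡b)
      where
      a≤v : c.to a ℕ.≤ c.to v
      a≤v = ℕ.<⇒≤ (ℕ.<-≤-trans a<N N≤v)

corollary6p2 : ExcludedMiddle 0ℓ →
    ∀ {ℝ : CompleteOrderedField} (𝔘 : MetricSpace ℝ) → IsUrysohn 𝔘 →
    (∀ (U : Pred (MetricSpace.Point 𝔘) 0ℓ) (c : Countable 𝔘 U) →
    Dense 𝔘 U → IntegerDistanceFree 𝔘 U → GeometricallyRado 𝔘 U c)
    ×
    (∀ (U₁ U₂ : Pred (MetricSpace.Point 𝔘) 0ℓ) →
    Countable 𝔘 U₁ → Dense 𝔘 U₁ → IntegerDistanceFree 𝔘 U₁ →
    Countable 𝔘 U₂ → Dense 𝔘 U₂ → IntegerDistanceFree 𝔘 U₂ →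
    (G₁ : Graph (subsetoid 𝔘 U₁)) (G₂ : Graph (subsetoid 𝔘 U₂)) →
    IsGEC 𝔘 U₁ G₁ → IsGEC 𝔘 U₂ G₂ → G₁ ≅ G₂)
corollary6p2 em {ℝ} 𝔘 isUrysohn = rado , gec⇒≅ em 𝔘 isUrysohn
  where
  -- The events range over both values of `g`. Outside their union both samplings are g.e.c., hence
  -- isomorphic by `gec⇒≅`, so non-isomorphic outcomes lie in a countable union of null sets.
  rado : ∀ U (c : Countable 𝔘 U) → Dense 𝔘 U → IntegerDistanceFree 𝔘 U → GeometricallyRado 𝔘 U c
  rado U c dense free p 0<p p<1 ε 0<ε =
    let cover , covers , small = null-⋃ event event-null ε 0<ε
    in cover
     , (λ ω ≇ → covers ω (decidable-stable em λ good → ≇ (gec⇒≅ em 𝔘 isUrysohn U U c dense free c dense free _ _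
         (good⇒gec (λ n bad → good (n , bad)) zero) (good⇒gec (λ n bad → good (n , bad)) (suc zero)))))
     , small
    where
    open Probability em ℝ p 0<p p<1 using (null-⋃)
    open RandomGraph em 𝔘 isUrysohn U c dense p 0<p p<1
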